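{- Let $\Phi$ be a finite irreducible crystallographic root system with simple system $\Pi$. There exists some positive real number $r$, with $r<2$, such that $\overline\alpha\in r\cdot\mathcal P_{\Phi_\alpha}$ for all $\alpha\in\Pi$.
   Context: $\Phi$ is reduced, in a Euclidean space $\mathbb E=\mathrm{Span}_{\mathbb R}\Phi$ with Weyl-group-invariant form. For $\alpha\in\Pi$, $\overline\alpha$ is the orthogonal projection of $\alpha$ onto $\mathrm{Span}(\Pi\setminus\{\alpha\})$; $\Phi_\alpha$ is the root subsystem generated by $\Pi\setminus\{\alpha\}$; $\mathcal P_{\Phi_\alpha}$ is its root polytope, i.e. the convex hull of $\Phi_\alpha$, with the convention that it is $\{0\}$ if $\Phi_\alpha=\emptyset$ (rank one case). -}

module Defs where

open import Algebra.Bundles using (CommutativeRing; AbelianGroup)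
open import Algebra.Core using (Op₁)
open import Algebra.Definitions using (Congruent₁)
open import Algebra.Module.Bundles using (Module)
import Algebra.Properties.CommutativeMonoid.Sum as CMSum
import Algebra.Properties.Monoid.Mult as Mult
open import Data.Fin.Base using (Fin)
open import Data.Integer.Base using (ℤ; +_; -[1+_])
open import Data.List.Base using (List; []; _++_)
import Data.List.Membership.Setoid as Membership
import Data.List.Relation.Binary.Permutation.Setoid as Permutation
open import Data.Nat.Base using (ℕ; suc)
open import Data.Product.Base using (∃; ∃-syntax; Σ-syntax; _×_)
open import Data.Sum.Base using (_⊎_)
open import Level using (Level; _⊔_) renaming (suc to lsuc)
open import Relation.Binary.Bundles using (Setoid)
open import Relation.Binary.Core using (Rel)
open import Relation.Binary.PropositionalEquality.Core using (_≡_; _≢_)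
open import Relation.Binary.Structures using (IsStrictTotalOrder)
open import Relation.Nullary.Negation.Core using (¬_)
open import Relation.Unary using (Pred; _∈_; Empty)

-- 0# ⁻¹ is left unspecified.
record OrderedField c ℓ₁ ℓ₂ : Set (lsuc (c ⊔ ℓ₁ ⊔ ℓ₂)) where
  field
    commutativeRing : CommutativeRing c ℓ₁
  open CommutativeRing commutativeRing public
  infix 8 _⁻¹
  infix 4 _<_ _≤_
  field
    _⁻¹                : Op₁ Carrier
    ⁻¹-cong            : Congruent₁ _≈_ _⁻¹
    ⁻¹-inverseʳ        : ∀ x → x ≉ 0# → x * x ⁻¹ ≈ 1#
    0≉1                : 0# ≉ 1#
    _<_                : Rel Carrier ℓ₂
    isStrictTotalOrder : IsStrictTotalOrder _≈_ _<_
    +-monoʳ-<          : ∀ x {y z} → y < z → x + y < x + z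
    *-pos              : ∀ {x y} → 0# < x → 0# < y → 0# < x * y

  _≤_ : Rel Carrier (ℓ₁ ⊔ ℓ₂)
  x ≤ y = x < y ⊎ x ≈ y

  2# : Carrier
  2# = 1# + 1#

  fromℤ : ℤ → Carrier
  fromℤ (+ n)    = Mult._×_ +-monoid n 1#
  fromℤ -[1+ n ] = - Mult._×_ +-monoid (suc n) 1#

-- The least-upper-bound property: classically, an ordered field having it is
-- the field of real numbers, up to a unique isomorphism.
DedekindComplete : ∀ {c ℓ₁ ℓ₂} → OrderedField c ℓ₁ ℓ₂ → Set (lsuc c ⊔ ℓ₁ ⊔ ℓ₂)
DedekindComplete {c} K = (S : Pred Carrier c) → ∃ S → ∃ (UpperBound S) →
  ∃[ s ] (UpperBound S s × (∀ b → UpperBound S b → s ≤ b))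
  where
  open OrderedField K
  UpperBound : Pred Carrier c → Carrier → Set _
  UpperBound S b = ∀ x → x ∈ S → x ≤ b

-- Finite-dimensionality is not a field: it follows from the existence of a
-- finite spanning root system.
record EuclideanSpace {c ℓ₁ ℓ₂} (ℝ : OrderedField c ℓ₁ ℓ₂) m ℓm
                      : Set (c ⊔ ℓ₁ ⊔ ℓ₂ ⊔ lsuc (m ⊔ ℓm)) where
  open OrderedField ℝ
  field
    module′ : Module commutativeRing m ℓm
  open Module module′ public
  field
    ⟨_,_⟩        : Carrierᴹ → Carrierᴹ → Carrier
    ⟨,⟩-cong     : ∀ {x x′ y y′} → x ≈ᴹ x′ → y ≈ᴹ y′ → ⟨ x , y ⟩ ≈ ⟨ x′ , y′ ⟩
    ⟨,⟩-sym      : ∀ x y → ⟨ x , y ⟩ ≈ ⟨ y , x ⟩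
    ⟨,⟩-additive : ∀ x y z → ⟨ x +ᴹ y , z ⟩ ≈ ⟨ x , z ⟩ + ⟨ y , z ⟩
    ⟨,⟩-scale    : ∀ a x y → ⟨ a *ₗ x , y ⟩ ≈ a * ⟨ x , y ⟩
    ⟨,⟩-nonneg   : ∀ x → 0# ≤ ⟨ x , x ⟩
    ⟨,⟩-definite : ∀ x → ⟨ x , x ⟩ ≈ 0# → x ≈ᴹ 0ᴹ

  vectorSetoid : Setoid m ℓm
  vectorSetoid = AbelianGroup.setoid +ᴹ-abelianGroup

  open CMSum +-commutativeMonoid public using (sum)
  open CMSum +ᴹ-commutativeMonoid public using () renaming (sum to sumᴹ)
  open Mult +ᴹ-monoid public using () renaming (_×_ to _·ℕ_)

  Span : ∀ {p} → Pred Carrierᴹ p → Pred Carrierᴹ (c ⊔ m ⊔ ℓm ⊔ p)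
  Span S x = Σ[ n ∈ ℕ ] Σ[ v ∈ (Fin n → Carrierᴹ) ] Σ[ a ∈ (Fin n → Carrier) ]
    ((∀ i → v i ∈ S) × x ≈ᴹ sumᴹ (λ i → a i *ₗ v i))

  ConvexHull : ∀ {p} → Pred Carrierᴹ p → Pred Carrierᴹ (c ⊔ ℓ₁ ⊔ ℓ₂ ⊔ m ⊔ ℓm ⊔ p)
  ConvexHull S x = Σ[ n ∈ ℕ ] Σ[ v ∈ (Fin n → Carrierᴹ) ] Σ[ a ∈ (Fin n → Carrier) ]
    ((∀ i → v i ∈ S) × (∀ i → 0# ≤ a i) × sum a ≈ 1# ×
     x ≈ᴹ sumᴹ (λ i → a i *ₗ v i))

  infix 7 _∙_
  _∙_ : ∀ {p} → Carrier → Pred Carrierᴹ p → Pred Carrierᴹ (m ⊔ ℓm ⊔ p)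
  (r ∙ S) x = ∃[ y ] (y ∈ S × x ≈ᴹ r *ₗ y)

  -- y is the orthogonal projection of x onto Span S (unique, since the form is
  -- positive definite).
  IsOrthogonalProjection : ∀ {p} → Pred Carrierᴹ p → Carrierᴹ → Carrierᴹ → Set _
  IsOrthogonalProjection S x y =
    y ∈ Span S × (∀ z → z ∈ Span S → ⟨ x +ᴹ -ᴹ y , z ⟩ ≈ 0#)

  -- 2⟨β,α⟩/⟨α,α⟩, the pairing of β with the coroot of α.
  pairing : Carrierᴹ → Carrierᴹ → Carrier
  pairing β α = 2# * ⟨ β , α ⟩ * ⟨ α , α ⟩ ⁻¹

  reflect : Carrierᴹ → Carrierᴹ → Carrierᴹ
  reflect α β = β +ᴹ -ᴹ (pairing β α *ₗ α)

  -- Smallest set containing S and closed under the reflections in its elements.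
  data Generated {p} (S : Pred Carrierᴹ p) : Pred Carrierᴹ (m ⊔ ℓm ⊔ p) where
    base       : ∀ {β} → β ∈ S → β ∈ Generated S
    reflection : ∀ {α β} → α ∈ Generated S → β ∈ Generated S →
                 reflect α β ∈ Generated S
    resp       : ∀ {α β} → α ≈ᴹ β → α ∈ Generated S → β ∈ Generated S

  -- The convex hull, with the convention that the polytope of the empty root
  -- system is {0}.
  RootPolytope : ∀ {p} → Pred Carrierᴹ p → Pred Carrierᴹ _
  RootPolytope Ψ x = x ∈ ConvexHull Ψ ⊎ (Empty Ψ × x ≈ᴹ 0ᴹ)

module _ {c ℓ₁ ℓ₂ m ℓm : Level} {ℝ : OrderedField c ℓ₁ ℓ₂} where
  open OrderedField ℝ

  -- A finite reduced crystallographic root system.  The reflections are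
  -- orthogonal, so the form is automatically invariant under the Weyl group.
  record RootSystem (E : EuclideanSpace ℝ m ℓm) : Set (c ⊔ ℓ₁ ⊔ m ⊔ ℓm) where
    open EuclideanSpace E
    open Membership vectorSetoid using () renaming (_∈_ to _∈ₗ_)
    field
      roots : List Carrierᴹ

    Φ : Pred Carrierᴹ (m ⊔ ℓm)
    Φ β = β ∈ₗ roots

    field
      spanning          : ∀ x → x ∈ Span Φ
      nonzero           : ∀ {α} → α ∈ Φ → α ≉ᴹ 0ᴹ
      reflection-closed : ∀ {α β} → α ∈ Φ → β ∈ Φ → reflect α β ∈ Φ
      crystallographic  : ∀ {α β} → α ∈ Φ → β ∈ Φ → ∃[ k ] pairing β α ≈ fromℤ k
      reduced           : ∀ {α} a → α ∈ Φ → a *ₗ α ∈ Φ → a ≈ 1# ⊎ a ≈ - 1#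

  module _ {E : EuclideanSpace ℝ m ℓm} (R : RootSystem E) where
    open EuclideanSpace E
    open RootSystem R
    open Permutation vectorSetoid using (_↭_)
    open Membership vectorSetoid using () renaming (_∈_ to _∈ₗ_)

    -- Φ is nonempty and has no partition into two nonempty mutually orthogonal
    -- subsets.  A root listed twice cannot occur in both Ψ₁ and Ψ₂, not being
    -- orthogonal to itself, so repetitions in the list are harmless.
    Irreducible : Set _
    Irreducible = roots ≢ [] × (∀ Ψ₁ Ψ₂ → roots ↭ Ψ₁ ++ Ψ₂ →
      (∀ β γ → β ∈ₗ Ψ₁ → γ ∈ₗ Ψ₂ → ⟨ β , γ ⟩ ≈ 0#) → Ψ₁ ≡ [] ⊎ Ψ₂ ≡ [])

    -- The simple roots are linearly independent (in particular distinct); they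
    -- span because Φ does, hence form a basis.
    record SimpleSystem : Set (c ⊔ ℓ₁ ⊔ m ⊔ ℓm) where
      field
        rank               : ℕ
        simple             : Fin rank → Carrierᴹ
        simple∈Φ           : ∀ i → simple i ∈ Φ
        linearIndependence : ∀ (a : Fin rank → Carrier) →
                             sumᴹ (λ i → a i *ₗ simple i) ≈ᴹ 0ᴹ → ∀ i → a i ≈ 0#
        sameSign           : ∀ {β} → β ∈ Φ → Σ[ k ∈ (Fin rank → ℕ) ]
          (β ≈ᴹ sumᴹ (λ i → k i ·ℕ simple i) ⊎
           β ≈ᴹ -ᴹ sumᴹ (λ i → k i ·ℕ simple i))

      -- Π ∖ {α}, where α is the i-th simple root.
      others : Fin rank → Pred Carrierᴹ ℓm
      others i β = ∃[ j ] (j ≢ i × β ≈ᴹ simple j)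

      Φ[_] : Fin rank → Pred Carrierᴹ (m ⊔ ℓm)
      Φ[ i ] = Generated (others i)

{-# OPTIONS --safe #-}

-- Fix α = simple i.  The simple roots are pairwise obtuse, so - ᾱ = Σ b j *ₗ simple j
-- with b ≥ 0 and b i = 0.  Let J be the set of simple roots other than α that are
-- perpendicular to α.  For a simple root β adjacent to α, the roots that agree with β
-- outside the J-coordinates lie in Φ[ i ] and are permuted by the reflections in J, so
-- their average is perpendicular to J.  Hence - ᾱ and Σ b β *ₗ average β, over the
-- adjacent β, have the same coordinates outside J and are both perpendicular to J, so
-- they are equal: their difference is perpendicular to itself.  Thus ± ᾱ are
-- nonnegative combinations of Φ[ i ] of mass s = Σ b β.  By integrality
-- ⟨ α , α ⟩ ≤ - 2 ⟨ β , α ⟩ for adjacent β, whence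
-- s ⟨ α , α ⟩ ≤ 2 ⟨ ᾱ , α ⟩ = 2 ⟨ ᾱ , ᾱ ⟩ < 2 ⟨ α , α ⟩, that is, s < 2.  As Φ[ i ] is
-- symmetric, the mass can be raised to any r ≥ s; take the largest s, but at least 1.
module Submission where

open import Defs
open import Data.Empty using (⊥-elim)
open import Data.Fin.Base using (Fin; zero; suc)
import Data.Integer.Base as ℤ
open import Data.Nat.Base as ℕ using (ℕ)
open import Data.Fin.Permutation using (permutation)
open import Data.List.Base using (length; lookup; filter; deduplicate)
open import Data.List.Membership.Setoid.Properties
  using (∈-resp-≈; ∈-lookup; ∈-filter⁺; ∈-filter⁻; ∈-deduplicate⁺; ∈-deduplicate⁻)
open import Data.List.Relation.Unary.AllPairs.Core using (_∷_)
open import Data.List.Relation.Unary.Any using (index)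
open import Data.List.Relation.Unary.Any.Properties using (lookup-index)
open import Data.List.Relation.Unary.Unique.Setoid using (Unique)
open import Data.List.Relation.Unary.Unique.Setoid.Properties
  using (filter⁺; Unique[x∷xs]⇒x∉xs)
open import Data.List.Relation.Unary.Unique.DecSetoid.Properties using (deduplicate-!)
open import Data.Product.Base using (Σ-syntax; ∃-syntax; _×_; _,_; proj₁; proj₂)
open import Data.Sum.Base using (_⊎_; inj₁; inj₂; [_,_]′)
open import Function.Base using (_∘_)
open import Level using (_⊔_)
open import Relation.Binary.Bundles using (DecSetoid; StrictTotalOrder)
open import Relation.Binary.Definitions using (tri<; tri≈; tri>)
open import Relation.Binary.PropositionalEquality.Core as ≡ using (_≡_; _≢_)
open import Relation.Nullary using (¬_; Dec; yes; no; ¬?; _→-dec_; _×-dec_)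
open import Relation.Unary using (Pred; Decidable; _∈_; _∩_; U)
import Algebra.Properties.AbelianGroup as AbelianGroupProperties
import Algebra.Properties.CommutativeMonoid.Sum as CMSum
import Algebra.Properties.Ring as RingProperties
import Algebra.Properties.Semiring.Sum as SemiringSum
import Data.Fin.Properties as Fin
import Data.List.Membership.Setoid as SetoidMembership
import Relation.Binary.Properties.StrictTotalOrder as STOProperties
import Relation.Binary.Reasoning.StrictPartialOrder as SPOReasoning

-- Ordered fields: inequalities, finite sums and integers.

module OrderedFieldProperties {c ℓ₁ ℓ₂} (K : OrderedField c ℓ₁ ℓ₂) where
  open OrderedField K hiding (zero)
  open RingProperties ring public
  open SemiringSum semiring public

  strictTotalOrder : StrictTotalOrder c ℓ₁ ℓ₂
  strictTotalOrder = record { isStrictTotalOrder = isStrictTotalOrder }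

  open StrictTotalOrder strictTotalOrder public
    using (compare; _≟_; _<?_; <-respˡ-≈; <-respʳ-≈; strictPartialOrder)
    renaming (trans to <-trans; irrefl to <-irrefl; asym to <-asym)
  open STOProperties strictTotalOrder public
    using () renaming
    (trans to ≤-trans; refl to ≤-refl; reflexive to ≤-reflexive; total to ≤-total; antisym to ≤-antisym)
  open SPOReasoning strictPartialOrder public

  <⇒≱ : ∀ {x y} → x < y → ¬ (y ≤ x)
  <⇒≱ x<y (inj₁ y<x) = <-asym x<y y<x
  <⇒≱ x<y (inj₂ y≈x) = <-irrefl (sym y≈x) x<y

  ≮⇒≥ : ∀ {x y} → ¬ (x < y) → y ≤ x
  ≮⇒≥ {x} {y} x≮y with compare x y
  ... | tri< x<y _ _ = ⊥-elim (x≮y x<y)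
  ... | tri≈ _ x≈y _ = inj₂ (sym x≈y)
  ... | tri> _ _ y<x = inj₁ y<x

  ≤∧≉⇒< : ∀ {x y} → x ≤ y → x ≉ y → x < y
  ≤∧≉⇒< (inj₁ x<y) _   = x<y
  ≤∧≉⇒< (inj₂ x≈y) x≉y = ⊥-elim (x≉y x≈y)

  +-monoʳ-≤ : ∀ x {y z} → y ≤ z → x + y ≤ x + z
  +-monoʳ-≤ x (inj₁ y<z) = inj₁ (+-monoʳ-< x y<z)
  +-monoʳ-≤ x (inj₂ y≈z) = inj₂ (+-congˡ y≈z)

  +-monoˡ-< : ∀ z {x y} → x < y → x + z < y + z
  +-monoˡ-< z {x} {y} x<y = begin-strict
    x + z  ≈⟨ +-comm x z ⟩
    z + x  <⟨ +-monoʳ-< z x<y ⟩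
    z + y  ≈⟨ +-comm z y ⟩
    y + z  ∎

  +-monoˡ-≤ : ∀ z {x y} → x ≤ y → x + z ≤ y + z
  +-monoˡ-≤ z (inj₁ x<y) = inj₁ (+-monoˡ-< z x<y)
  +-monoˡ-≤ z (inj₂ x≈y) = inj₂ (+-congʳ x≈y)

  +-mono-≤ : ∀ {x y u v} → x ≤ y → u ≤ v → x + u ≤ y + v
  +-mono-≤ {y = y} {u} x≤y u≤v = ≤-trans (+-monoˡ-≤ u x≤y) (+-monoʳ-≤ y u≤v)

  +-mono-< : ∀ {x y u v} → x < y → u < v → x + u < y + v
  +-mono-< {y = y} {u} x<y u<v = <-trans (+-monoˡ-< u x<y) (+-monoʳ-< y u<v)

  +-nonNeg : ∀ {x y} → 0# ≤ x → 0# ≤ y → 0# ≤ x + y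
  +-nonNeg 0≤x 0≤y = ≤-trans (≤-reflexive (sym (+-identityˡ 0#))) (+-mono-≤ 0≤x 0≤y)

  neg-mono-≤ : ∀ {x y} → x ≤ y → - y ≤ - x
  neg-mono-≤ {x} {y} x≤y = begin
    - y              ≈⟨ +-identityʳ (- y) ⟨
    - y + 0#         ≈⟨ +-congˡ (-‿inverseʳ x) ⟨
    - y + (x - x)    ≈⟨ +-assoc (- y) x (- x) ⟨
    (- y + x) - x    ≤⟨ +-monoˡ-≤ (- x) (+-monoʳ-≤ (- y) x≤y) ⟩
    (- y + y) - x    ≈⟨ +-congʳ (-‿inverseˡ y) ⟩
    0# - x           ≈⟨ +-identityˡ (- x) ⟩
    - x              ∎

  x≤0⇒0≤-x : ∀ {x} → x ≤ 0# → 0# ≤ - x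
  x≤0⇒0≤-x {x} x≤0 = ≤-trans (≤-reflexive (sym -0#≈0#)) (neg-mono-≤ x≤0)

  0≤x⇒-x≤0 : ∀ {x} → 0# ≤ x → - x ≤ 0#
  0≤x⇒-x≤0 {x} 0≤x = ≤-trans (neg-mono-≤ 0≤x) (≤-reflexive -0#≈0#)

  x<0⇒0<-x : ∀ {x} → x < 0# → 0# < - x
  x<0⇒0<-x {x} x<0 = ≤∧≉⇒< (x≤0⇒0≤-x (inj₁ x<0)) λ 0≈-x →
    <-irrefl (trans (sym (-‿involutive x)) (trans (-‿cong (sym 0≈-x)) -0#≈0#)) x<0

  x≤y⇒0≤y-x : ∀ {x y} → x ≤ y → 0# ≤ y - x
  x≤y⇒0≤y-x {x} {y} x≤y = begin
    0#     ≈⟨ -‿inverseʳ x ⟨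
    x - x  ≤⟨ +-monoˡ-≤ (- x) x≤y ⟩
    y - x  ∎

  *-nonNeg : ∀ {x y} → 0# ≤ x → 0# ≤ y → 0# ≤ x * y
  *-nonNeg (inj₁ 0<x) (inj₁ 0<y) = inj₁ (*-pos 0<x 0<y)
  *-nonNeg {x} {y} (inj₂ 0≈x) _  = inj₂ (sym (trans (*-congʳ (sym 0≈x)) (zeroˡ y)))
  *-nonNeg {x} {y} _ (inj₂ 0≈y)  = inj₂ (sym (trans (*-congˡ (sym 0≈y)) (zeroʳ x)))

  *-nonNeg-nonPos : ∀ {x y} → 0# ≤ x → y ≤ 0# → x * y ≤ 0#
  *-nonNeg-nonPos {x} {y} 0≤x y≤0 = begin
    x * y          ≈⟨ -‿involutive (x * y) ⟨
    - - (x * y)    ≈⟨ -‿cong (-‿distribʳ-* x y) ⟩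
    - (x * - y)    ≤⟨ 0≤x⇒-x≤0 (*-nonNeg 0≤x (x≤0⇒0≤-x y≤0)) ⟩
    0#             ∎

  *-monoˡ-≤ : ∀ {x y z} → 0# ≤ z → x ≤ y → z * x ≤ z * y
  *-monoˡ-≤ {x} {y} {z} 0≤z x≤y = begin
    z * x                    ≈⟨ +-identityʳ (z * x) ⟨
    z * x + 0#               ≤⟨ +-monoʳ-≤ (z * x) (*-nonNeg 0≤z (x≤y⇒0≤y-x x≤y)) ⟩
    z * x + z * (y - x)      ≈⟨ distribˡ z x (y - x) ⟨
    z * (x + (y - x))        ≈⟨ *-congˡ (+-congˡ (+-comm y (- x))) ⟩
    z * (x + (- x + y))      ≈⟨ *-congˡ (+-assoc x (- x) y) ⟨
    z * ((x - x) + y)        ≈⟨ *-congˡ (+-congʳ (-‿inverseʳ x)) ⟩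
    z * (0# + y)             ≈⟨ *-congˡ (+-identityˡ y) ⟩
    z * y                    ∎

  -- Contrapositive of `*-monoˡ-≤`.
  *-cancelʳ-< : ∀ {x y z} → 0# ≤ z → x * z < y * z → x < y
  *-cancelʳ-< {x} {y} {z} 0≤z xz<yz with x <? y
  ... | yes x<y = x<y
  ... | no  x≮y = ⊥-elim (<⇒≱ xz<yz (begin
    y * z  ≈⟨ *-comm y z ⟩
    z * y  ≤⟨ *-monoˡ-≤ 0≤z (≮⇒≥ x≮y) ⟩
    z * x  ≈⟨ *-comm z x ⟩
    x * z  ∎))

  0<x*y⇒0<y : ∀ {x y} → 0# ≤ x → 0# < x * y → 0# < y
  0<x*y⇒0<y {x} {y} 0≤x 0<xy with 0# <? y
  ... | yes 0<y = 0<y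
  ... | no  0≮y = ⊥-elim (<⇒≱ 0<xy (*-nonNeg-nonPos 0≤x (≮⇒≥ 0≮y)))

  0<1 : 0# < 1#
  0<1 with compare 0# 1#
  ... | tri< 0<1 _ _ = 0<1
  ... | tri≈ _ 0≈1 _ = ⊥-elim (0≉1 0≈1)
  -- A negative `1#` would be positive after all, being the square of `- 1#`.
  ... | tri> _ _ 1<0 = <-respʳ-≈
    (trans (sym (-‿distribˡ-* 1# (- 1#))) (trans (-‿cong (*-identityˡ (- 1#))) (-‿involutive 1#)))
    (*-pos (x<0⇒0<-x 1<0) (x<0⇒0<-x 1<0))

  x<1+x : ∀ x → x < 1# + x
  x<1+x x = <-respˡ-≈ (+-identityˡ x) (+-monoˡ-< x 0<1)

  1<2 : 1# < 2#
  1<2 = x<1+x 1#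

  0<2 : 0# < 2#
  0<2 = <-trans 0<1 1<2

  ⁻¹-pos : ∀ {x} → 0# < x → 0# < x ⁻¹
  ⁻¹-pos {x} 0<x = 0<x*y⇒0<y (inj₁ 0<x)
    (<-respʳ-≈ (sym (⁻¹-inverseʳ x λ x≈0 → <-irrefl (sym x≈0) 0<x)) 0<1)

  ⁻¹-inverseʳ-pos : ∀ {x} → 0# < x → x * x ⁻¹ ≈ 1#
  ⁻¹-inverseʳ-pos {x} 0<x = ⁻¹-inverseʳ x λ x≈0 → <-irrefl (sym x≈0) 0<x

  2x≈x+x : ∀ x → 2# * x ≈ x + x
  2x≈x+x x = trans (distribʳ x 1# 1#) (+-cong (*-identityˡ x) (*-identityˡ x))

  -- Trichotomy stands in for division by two: a nonzero element and its negative have opposite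
  -- signs. `sum-orthogonal` rests on this.
  x≈-x⇒x≈0 : ∀ {x} → x ≈ - x → x ≈ 0#
  x≈-x⇒x≈0 {x} x≈-x with compare x 0#
  ... | tri< x<0 _ _ = ⊥-elim (<-asym x<0 (<-respʳ-≈ (sym x≈-x) (x<0⇒0<-x x<0)))
  ... | tri≈ _ x≈0 _ = x≈0
  ... | tri> _ _ 0<x = ⊥-elim (<⇒≱ 0<x (≤-trans (≤-reflexive x≈-x) (0≤x⇒-x≤0 (inj₁ 0<x))))

  sum-zero : ∀ {n} {f : Fin n → Carrier} → (∀ i → f i ≈ 0#) → sum f ≈ 0#
  sum-zero {n} f≈0 = trans (sum-cong-≋ f≈0) (sum-replicate-zero n)

  sum-mono-≤ : ∀ {n} {f g : Fin n → Carrier} → (∀ i → f i ≤ g i) → sum f ≤ sum g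
  sum-mono-≤ {ℕ.zero}  f≤g = ≤-refl
  sum-mono-≤ {ℕ.suc n} f≤g = +-mono-≤ (f≤g zero) (sum-mono-≤ (f≤g ∘ suc))

  sum-nonNeg : ∀ {n} {f : Fin n → Carrier} → (∀ i → 0# ≤ f i) → 0# ≤ sum f
  sum-nonNeg {n} 0≤f = ≤-trans (≤-reflexive (sym (sum-replicate-zero n))) (sum-mono-≤ 0≤f)

  sum-nonPos : ∀ {n} {f : Fin n → Carrier} → (∀ i → f i ≤ 0#) → sum f ≤ 0#
  sum-nonPos {n} f≤0 = ≤-trans (sum-mono-≤ f≤0) (≤-reflexive (sum-replicate-zero n))

  sum-neg : ∀ {n} (f : Fin n → Carrier) → sum (λ i → - f i) ≈ - sum f
  sum-neg {ℕ.zero}  f = sym -0#≈0#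
  sum-neg {ℕ.suc n} f = trans (+-congˡ (sum-neg (f ∘ suc))) (-‿+-comm _ _)

  sum-pos⇒∃pos : ∀ {n} {f : Fin n → Carrier} → 0# < sum f → ∃[ i ] 0# < f i
  sum-pos⇒∃pos {ℕ.zero}  0<0 = ⊥-elim (<-irrefl refl 0<0)
  sum-pos⇒∃pos {ℕ.suc n} {f} 0<Σ with 0# <? f zero | 0# <? sum (f ∘ suc)
  ... | yes 0<f₀ | _        = zero , 0<f₀
  ... | no  _    | yes 0<Σ′ = let i , 0<fᵢ = sum-pos⇒∃pos 0<Σ′ in suc i , 0<fᵢ
  ... | no  f₀≤0 | no  Σ′≤0 = ⊥-elim (<⇒≱ 0<Σ
    (≤-trans (+-mono-≤ (≮⇒≥ f₀≤0) (≮⇒≥ Σ′≤0)) (≤-reflexive (+-identityˡ 0#))))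

  infixl 8 _·1
  _·1 : ℕ → Carrier
  n ·1 = fromℤ (ℤ.+ n)

  ·1-nonNeg : ∀ n → 0# ≤ n ·1
  ·1-nonNeg ℕ.zero    = ≤-refl
  ·1-nonNeg (ℕ.suc n) = +-nonNeg (inj₁ 0<1) (·1-nonNeg n)

  suc·1-pos : ∀ n → 0# < ℕ.suc n ·1
  suc·1-pos n = begin-strict
    0#          ≤⟨ ·1-nonNeg n ⟩
    n ·1        <⟨ x<1+x (n ·1) ⟩
    ℕ.suc n ·1  ∎

  ·1-homo-+ : ∀ m n → (m ℕ.+ n) ·1 ≈ m ·1 + n ·1
  ·1-homo-+ ℕ.zero    n = sym (+-identityˡ (n ·1))
  ·1-homo-+ (ℕ.suc m) n = trans (+-congˡ (·1-homo-+ m n)) (sym (+-assoc 1# (m ·1) (n ·1)))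

  -- Discreteness of the integers, the source of the lower bound on positive pairings.
  fromℤ-pos⇒≥1 : ∀ k → 0# < fromℤ k → 1# ≤ fromℤ k
  fromℤ-pos⇒≥1 (ℤ.+ ℕ.zero)  0<0 = ⊥-elim (<-irrefl refl 0<0)
  fromℤ-pos⇒≥1 (ℤ.+ ℕ.suc n) _   =
    ≤-trans (≤-reflexive (sym (+-identityʳ 1#))) (+-monoʳ-≤ 1# (·1-nonNeg n))
  fromℤ-pos⇒≥1 ℤ.-[1+ n ]    0<k = ⊥-elim (<⇒≱ 0<k (0≤x⇒-x≤0 (·1-nonNeg (ℕ.suc n))))

  -- Heights are field elements, so a descent on them takes a natural number as its measure. One
  -- more than the total of the coefficients makes the bound strict.
  sum-bounded : ∀ {n} (f : Fin n → ℕ) → ∃[ N ] sum (λ i → f i ·1) < N ·1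
  sum-bounded f = ℕ.suc (total f) , <-respˡ-≈ (sum≈total f) (x<1+x (total f ·1))
    where
    total : ∀ {n} → (Fin n → ℕ) → ℕ
    total {ℕ.zero}  f = 0
    total {ℕ.suc n} f = f zero ℕ.+ total (f ∘ suc)
    sum≈total : ∀ {n} (f : Fin n → ℕ) → total f ·1 ≈ sum (λ i → f i ·1)
    sum≈total {ℕ.zero}  f = refl
    sum≈total {ℕ.suc n} f = trans (·1-homo-+ (f zero) _) (+-congˡ (sum≈total (f ∘ suc)))

  -- A running maximum that starts at `a`: `r` is `a` or one of the values, hence still strictly
  -- below `b`.
  upperBound : ∀ {n a b} → a < b → (f : Fin n → Carrier) → (∀ i → f i < b) →
               ∃[ r ] (a ≤ r × r < b × (∀ i → f i ≤ r))
  upperBound {ℕ.zero}  {a} a<b f f<b = a , ≤-refl , a<b , λ ()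
  upperBound {ℕ.suc n} a<b f f<b with upperBound a<b (f ∘ suc) (f<b ∘ suc)
  ... | r , a≤r , r<b , f≤r with ≤-total r (f zero)
  ... | inj₁ r≤f₀ = f zero , ≤-trans a≤r r≤f₀ , f<b zero ,
                    λ { zero → ≤-refl ; (suc i) → ≤-trans (f≤r i) r≤f₀ }
  ... | inj₂ f₀≤r = r , a≤r , r<b , λ { zero → f₀≤r ; (suc i) → f≤r i }

-- Linear functionals on a Euclidean space.

module EuclideanProperties {c ℓ₁ ℓ₂ m ℓm} {K : OrderedField c ℓ₁ ℓ₂}
                           (E : EuclideanSpace K m ℓm) where
  open OrderedField K hiding (zero)
  open OrderedFieldProperties K
  open EuclideanSpace E hiding (sum)
  open SetoidMembership vectorSetoid using () renaming (_∈_ to _∈ₗ_)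
  open AbelianGroupProperties +ᴹ-abelianGroup
    using () renaming (x≈y⇒x∙y⁻¹≈ε to x≈y⇒x-y≈0ᴹ; x∙y⁻¹≈ε⇒x≈y to x-y≈0⇒x≈y)

  infixl 6 _-ᴹ_
  _-ᴹ_ : Carrierᴹ → Carrierᴹ → Carrierᴹ
  x -ᴹ y = x +ᴹ -ᴹ y

  combination : ∀ {n} → (Fin n → Carrier) → (Fin n → Carrierᴹ) → Carrierᴹ
  combination a v = sumᴹ (λ i → a i *ₗ v i)

  -- Inner products, pairings, coordinates and the height are all instances, so each is evaluated on
  -- sums, combinations and reflections by the same lemmas.
  record Linear (f : Carrierᴹ → Carrier) : Set (c ⊔ ℓ₁ ⊔ m ⊔ ℓm) where
    field
      cong    : ∀ {x y} → x ≈ᴹ y → f x ≈ f y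
      homo-+  : ∀ x y → f (x +ᴹ y) ≈ f x + f y
      homo-*ₗ : ∀ a x → f (a *ₗ x) ≈ a * f x

    homo-0 : f 0ᴹ ≈ 0#
    homo-0 = trans (cong (≈ᴹ-sym (*ₗ-zeroˡ 0ᴹ))) (trans (homo-*ₗ 0# 0ᴹ) (zeroˡ _))

    homo-neg : ∀ x → f (-ᴹ x) ≈ - f x
    homo-neg x = +-inverseˡ-unique _ _
      (trans (sym (homo-+ (-ᴹ x) x)) (trans (cong (-ᴹ‿inverseˡ x)) homo-0))

    homo-- : ∀ x y → f (x -ᴹ y) ≈ f x - f y
    homo-- x y = trans (homo-+ x (-ᴹ y)) (+-congˡ (homo-neg y))

    homo-sum : ∀ {n} (v : Fin n → Carrierᴹ) → f (sumᴹ v) ≈ sum (λ i → f (v i))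
    homo-sum {ℕ.zero}  v = homo-0
    homo-sum {ℕ.suc n} v = trans (homo-+ _ _) (+-congˡ (homo-sum (v ∘ suc)))

    homo-combination : ∀ {n} (a : Fin n → Carrier) v →
                       f (combination a v) ≈ sum (λ i → a i * f (v i))
    homo-combination a v = trans (homo-sum (λ i → a i *ₗ v i)) (sum-cong-≋ λ i → homo-*ₗ (a i) (v i))

    vanishes-on-Span : ∀ {p} {S : Pred Carrierᴹ p} → (∀ {x} → x ∈ S → f x ≈ 0#) →
                       ∀ {x} → x ∈ Span S → f x ≈ 0#
    vanishes-on-Span fS≈0 (_ , v , a , v∈S , x≈) = trans (cong x≈) (trans (homo-combination a v)
      (sum-zero λ i → trans (*-congˡ (fS≈0 (v∈S i))) (zeroʳ (a i))))

  open Linear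

  linearˡ : ∀ z → Linear (λ x → ⟨ x , z ⟩)
  linearˡ z = record
    { cong    = λ x≈y → ⟨,⟩-cong x≈y ≈ᴹ-refl
    ; homo-+  = λ x y → ⟨,⟩-additive x y z
    ; homo-*ₗ = λ a x → ⟨,⟩-scale a x z
    }

  linearʳ : ∀ z → Linear (λ x → ⟨ z , x ⟩)
  linearʳ z = record
    { cong    = ⟨,⟩-cong ≈ᴹ-refl
    ; homo-+  = λ x y → trans (⟨,⟩-sym z _) (trans (⟨,⟩-additive x y z) (+-cong (⟨,⟩-sym x z) (⟨,⟩-sym y z)))
    ; homo-*ₗ = λ a x → trans (⟨,⟩-sym z _) (trans (⟨,⟩-scale a x z) (*-congˡ (⟨,⟩-sym x z)))
    }

  ⟨,⟩-pos : ∀ {x} → x ≉ᴹ 0ᴹ → 0# < ⟨ x , x ⟩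
  ⟨,⟩-pos {x} x≉0 = ≤∧≉⇒< (⟨,⟩-nonneg x) λ 0≈xx → x≉0 (⟨,⟩-definite x (sym 0≈xx))

  -- Test against `x -ᴹ y` itself. Vector identities thereby reduce to computations in the field.
  ⟨,⟩-extensional : ∀ {x y} → (∀ z → ⟨ x , z ⟩ ≈ ⟨ y , z ⟩) → x ≈ᴹ y
  ⟨,⟩-extensional {x} {y} eq = x-y≈0⇒x≈y x y (⟨,⟩-definite _
    (trans (homo-- (linearˡ _) x y) (trans (+-congʳ (eq _)) (-‿inverseʳ _))))

  *ₗ-neg1 : ∀ x → - 1# *ₗ x ≈ᴹ -ᴹ x
  *ₗ-neg1 x = ⟨,⟩-extensional λ z → let L = linearˡ z in
    trans (homo-*ₗ L (- 1#) x) (trans (-1*x≈-x _) (sym (homo-neg L x)))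

  infix 4 _≟ᴹ_
  -- Field equality is decidable by trichotomy, and definiteness transfers this to vectors through
  -- the squared norm of the difference.
  _≟ᴹ_ : ∀ x y → Dec (x ≈ᴹ y)
  x ≟ᴹ y with ⟨ x -ᴹ y , x -ᴹ y ⟩ ≟ 0#
  ... | yes ≈0 = yes (x-y≈0⇒x≈y x y (⟨,⟩-definite _ ≈0))
  ... | no  ≉0 = no λ x≈y → ≉0 (trans (⟨,⟩-cong (x≈y⇒x-y≈0ᴹ x≈y) ≈ᴹ-refl) (homo-0 (linearˡ _)))

  -- Linear combinations with prescribed mass.

  -- Linear combinations of elements of S with coefficients in P and coefficient
  -- sum s, built one summand at a time so that adding two of them is a recursion.
  data Comb {p q} (P : Pred Carrier p) (S : Pred Carrierᴹ q) (s : Carrier) (x : Carrierᴹ)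
            : Set (c ⊔ ℓ₁ ⊔ m ⊔ ℓm ⊔ p ⊔ q) where
    nil  : s ≈ 0# → x ≈ᴹ 0ᴹ → Comb P S s x
    cons : ∀ {a v t y} → a ∈ P → v ∈ S → Comb P S t y →
           s ≈ a + t → x ≈ᴹ a *ₗ v +ᴹ y → Comb P S s x

  module _ {p q} {P : Pred Carrier p} {S : Pred Carrierᴹ q} where

    Comb-resp : ∀ {s t x y} → s ≈ t → x ≈ᴹ y → Comb P S s x → Comb P S t y
    Comb-resp s≈t x≈y (nil s≈ x≈) = nil (trans (sym s≈t) s≈) (≈ᴹ-trans (≈ᴹ-sym x≈y) x≈)
    Comb-resp s≈t x≈y (cons a∈P v∈S d s≈ x≈) =
      cons a∈P v∈S d (trans (sym s≈t) s≈) (≈ᴹ-trans (≈ᴹ-sym x≈y) x≈)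

    Comb-single : ∀ {a v} → a ∈ P → v ∈ S → Comb P S a (a *ₗ v)
    Comb-single a∈P v∈S =
      cons a∈P v∈S (nil refl ≈ᴹ-refl) (sym (+-identityʳ _)) (≈ᴹ-sym (+ᴹ-identityʳ _))

    Comb-+ : ∀ {s t x y} → Comb P S s x → Comb P S t y → Comb P S (s + t) (x +ᴹ y)
    Comb-+ (nil s≈0 x≈0) e = Comb-resp
      (trans (sym (+-identityˡ _)) (+-congʳ (sym s≈0)))
      (≈ᴹ-trans (≈ᴹ-sym (+ᴹ-identityˡ _)) (+ᴹ-congʳ (≈ᴹ-sym x≈0))) e
    Comb-+ (cons a∈P v∈S d s≈ x≈) e = cons a∈P v∈S (Comb-+ d e)
      (trans (+-congʳ s≈) (+-assoc _ _ _)) (≈ᴹ-trans (+ᴹ-congʳ x≈) (+ᴹ-assoc _ _ _))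

    Comb-sum : ∀ {n} (s : Fin n → Carrier) (x : Fin n → Carrierᴹ) →
               (∀ i → Comb P S (s i) (x i)) → Comb P S (sum s) (sumᴹ x)
    Comb-sum {ℕ.zero}  s x d = nil refl ≈ᴹ-refl
    Comb-sum {ℕ.suc n} s x d = Comb-+ (d zero) (Comb-sum (s ∘ suc) (x ∘ suc) (d ∘ suc))

    Comb-scale : ∀ {k} → (∀ {a} → a ∈ P → k * a ∈ P) →
                 ∀ {s x} → Comb P S s x → Comb P S (k * s) (k *ₗ x)
    Comb-scale {k} kP⊆P (nil s≈0 x≈0) =
      nil (trans (*-congˡ s≈0) (zeroʳ k)) (≈ᴹ-trans (*ₗ-congˡ x≈0) (*ₗ-zeroʳ k))
    Comb-scale {k} kP⊆P (cons {a} {v} {t} {y} a∈P v∈S d s≈ x≈) =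
      cons (kP⊆P a∈P) v∈S (Comb-scale kP⊆P d)
        (trans (*-congˡ s≈) (distribˡ k a t))
        (≈ᴹ-trans (*ₗ-congˡ x≈) (≈ᴹ-trans (*ₗ-distribˡ k _ y) (+ᴹ-congʳ (≈ᴹ-sym (*ₗ-assoc k a v)))))

    Comb-family : ∀ {s x} → Comb P S s x →
      Σ[ n ∈ ℕ ] Σ[ v ∈ (Fin n → Carrierᴹ) ] Σ[ a ∈ (Fin n → Carrier) ]
        ((∀ i → v i ∈ S) × (∀ i → a i ∈ P) × sum a ≈ s × x ≈ᴹ combination a v)
    Comb-family (nil s≈0 x≈0) = 0 , (λ ()) , (λ ()) , (λ ()) , (λ ()) , sym s≈0 , x≈0
    Comb-family (cons {a} {v} a∈P v∈S d s≈ x≈) with Comb-family d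
    ... | n , w , b , w∈S , b∈P , Σb≈ , y≈ =
      ℕ.suc n , (λ { zero → v ; (suc i) → w i }) , (λ { zero → a ; (suc i) → b i }) ,
      (λ { zero → v∈S ; (suc i) → w∈S i }) , (λ { zero → a∈P ; (suc i) → b∈P i }) ,
      trans (+-congˡ Σb≈) (sym s≈) , ≈ᴹ-trans x≈ (+ᴹ-congˡ y≈)

  Comb-map : ∀ {p q r} {P : Pred Carrier p} {S : Pred Carrierᴹ q} {T : Pred Carrierᴹ r} →
             (∀ {v} → v ∈ S → v ∈ T) → ∀ {s x} → Comb P S s x → Comb P T s x
  Comb-map S⊆T (nil s≈ x≈)            = nil s≈ x≈
  Comb-map S⊆T (cons a∈P v∈S d s≈ x≈) = cons a∈P (S⊆T v∈S) (Comb-map S⊆T d) s≈ x≈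

  NonNeg : Pred Carrier (ℓ₁ ⊔ ℓ₂)
  NonNeg a = 0# ≤ a

  Comb⇒ConvexHull : ∀ {q} {S : Pred Carrierᴹ q} {x} → Comb NonNeg S 1# x → x ∈ ConvexHull S
  Comb⇒ConvexHull = Comb-family

  InSpan : ∀ {q} → Pred Carrierᴹ q → Pred Carrierᴹ _
  InSpan S x = ∃[ s ] Comb U S s x

  InSpan⇒Span : ∀ {q} {S : Pred Carrierᴹ q} {x} → InSpan S x → x ∈ Span S
  InSpan⇒Span (_ , d) = let n , v , a , v∈S , _ , _ , x≈ = Comb-family d in n , v , a , v∈S , x≈

  neg-combine : ∀ {a v x y} → x ≈ᴹ a *ₗ v +ᴹ y → -ᴹ x ≈ᴹ a *ₗ (-ᴹ v) +ᴹ (-ᴹ y)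
  neg-combine {a} {v} {x} {y} x≈ = ⟨,⟩-extensional λ z → let L = linearˡ z in begin-equality
    ⟨ -ᴹ x , z ⟩                             ≈⟨ homo-neg L x ⟩
    - ⟨ x , z ⟩                              ≈⟨ -‿cong (trans (cong L x≈) (homo-+ L _ y)) ⟩
    - (⟨ a *ₗ v , z ⟩ + ⟨ y , z ⟩)           ≈⟨ -‿+-comm _ _ ⟨
    - ⟨ a *ₗ v , z ⟩ - ⟨ y , z ⟩             ≈⟨ +-cong (-‿cong (homo-*ₗ L a v)) (sym (homo-neg L y)) ⟩
    - (a * ⟨ v , z ⟩) + ⟨ -ᴹ y , z ⟩         ≈⟨ +-congʳ (trans (-‿distribʳ-* a _) (*-congˡ (sym (homo-neg L v)))) ⟩
    a * ⟨ -ᴹ v , z ⟩ + ⟨ -ᴹ y , z ⟩          ≈⟨ +-congʳ (homo-*ₗ L a (-ᴹ v)) ⟨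
    ⟨ a *ₗ (-ᴹ v) , z ⟩ + ⟨ -ᴹ y , z ⟩       ≈⟨ homo-+ L _ (-ᴹ y) ⟨
    ⟨ a *ₗ (-ᴹ v) +ᴹ (-ᴹ y) , z ⟩            ∎

  Comb-neg : ∀ {p q} {P : Pred Carrier p} {S : Pred Carrierᴹ q} → (∀ {v} → v ∈ S → -ᴹ v ∈ S) →
             ∀ {s x} → Comb P S s x → Comb P S s (-ᴹ x)
  Comb-neg -S⊆S (nil s≈ x≈) = nil s≈ (≈ᴹ-trans (-ᴹ‿cong x≈) (⟨,⟩-extensional λ z →
    trans (homo-neg (linearˡ z) 0ᴹ) (trans (-‿cong (homo-0 (linearˡ z)))
      (trans -0#≈0# (sym (homo-0 (linearˡ z)))))))
  Comb-neg -S⊆S (cons a∈P v∈S d s≈ x≈) = cons a∈P (-S⊆S v∈S) (Comb-neg -S⊆S d) s≈ (neg-combine x≈)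

  -- Orthogonal projection and linear functionals on combinations.

  -- Gram-Schmidt by recursion, for a family that may be dependent: `w` is the part of `v zero`
  -- perpendicular to the later vectors, and the projection onto those is corrected along `w`. The
  -- last conjunct places `y` in the double orthogonal complement of the family; it is what turns
  -- orthogonality to `w` into orthogonality to `v zero`.
  project : ∀ {q} {S : Pred Carrierᴹ q} {n} (v : Fin n → Carrierᴹ) → (∀ i → InSpan S (v i)) →
            ∀ x → ∃[ y ] (InSpan S y × (∀ i → ⟨ x -ᴹ y , v i ⟩ ≈ 0#) ×
                          (∀ z → (∀ i → ⟨ z , v i ⟩ ≈ 0#) → ⟨ z , y ⟩ ≈ 0#))
  project {n = ℕ.zero}  v v∈S x =
    0ᴹ , (0# , nil refl ≈ᴹ-refl) , (λ ()) , λ z _ → homo-0 (linearʳ z)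
  project {n = ℕ.suc n} v v∈S x
    with project (v ∘ suc) (v∈S ∘ suc) x | project (v ∘ suc) (v∈S ∘ suc) (v zero)
  ... | y , (_ , y∈S) , x-y⊥v , v⊥⇒y⊥ | u , (_ , u∈S) , w⊥v , v⊥⇒u⊥ =
    y +ᴹ t *ₗ w , (_ , Comb-+ y∈S (Comb-scale _ w∈S)) , (λ { zero → ⊥v₀ ; (suc i) → ⊥v i }) , v⊥⇒⊥
    where
    w = v zero -ᴹ u
    -- If `w` vanishes the inverse is unspecified, but then `t *ₗ w` vanishes whatever `t` is.
    t = ⟨ x -ᴹ y , w ⟩ * ⟨ w , w ⟩ ⁻¹
    z = x -ᴹ (y +ᴹ t *ₗ w)
    w∈S : Comb U _ _ w
    w∈S = Comb-+ (proj₂ (v∈S zero))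
      (Comb-resp refl (*ₗ-neg1 u) (Comb-scale {k = - 1#} _ u∈S))
    ⟨z,-⟩ : ∀ a → ⟨ z , a ⟩ ≈ ⟨ x -ᴹ y , a ⟩ - t * ⟨ w , a ⟩
    ⟨z,-⟩ a = let L = linearˡ a in begin-equality
      ⟨ z , a ⟩                                          ≈⟨ homo-- L x _ ⟩
      ⟨ x , a ⟩ - ⟨ y +ᴹ t *ₗ w , a ⟩                    ≈⟨ +-congˡ (-‿cong (homo-+ L y _)) ⟩
      ⟨ x , a ⟩ - (⟨ y , a ⟩ + ⟨ t *ₗ w , a ⟩)           ≈⟨ +-congˡ (-‿+-comm _ _) ⟨
      ⟨ x , a ⟩ + (- ⟨ y , a ⟩ - ⟨ t *ₗ w , a ⟩)         ≈⟨ +-assoc _ _ _ ⟨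
      ⟨ x , a ⟩ - ⟨ y , a ⟩ - ⟨ t *ₗ w , a ⟩             ≈⟨ +-cong (homo-- L x y) (-‿cong (sym (homo-*ₗ L t w))) ⟨
      ⟨ x -ᴹ y , a ⟩ - t * ⟨ w , a ⟩                     ∎
    ⊥v : ∀ i → ⟨ z , v (suc i) ⟩ ≈ 0#
    ⊥v i = trans (⟨z,-⟩ _) (trans (+-cong (x-y⊥v i) (-‿cong (trans (*-congˡ (w⊥v i)) (zeroʳ t))))
                                  (-‿inverseʳ 0#))
    ⊥w : ⟨ z , w ⟩ ≈ 0#
    ⊥w with w ≟ᴹ 0ᴹ
    ... | yes w≈0 = trans (cong (linearʳ z) w≈0) (homo-0 (linearʳ z))
    ... | no  w≉0 = trans (⟨z,-⟩ w) (trans (+-congˡ (-‿cong (begin-equality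
      ⟨ x -ᴹ y , w ⟩ * ⟨ w , w ⟩ ⁻¹ * ⟨ w , w ⟩     ≈⟨ *-assoc _ _ _ ⟩
      ⟨ x -ᴹ y , w ⟩ * (⟨ w , w ⟩ ⁻¹ * ⟨ w , w ⟩)   ≈⟨ *-congˡ (trans (*-comm _ _) (⁻¹-inverseʳ-pos (⟨,⟩-pos w≉0))) ⟩
      ⟨ x -ᴹ y , w ⟩ * 1#                           ≈⟨ *-identityʳ _ ⟩
      ⟨ x -ᴹ y , w ⟩                                ∎))) (-‿inverseʳ _))
    ⊥v₀ : ⟨ z , v zero ⟩ ≈ 0#
    ⊥v₀ = begin-equality
      ⟨ z , v zero ⟩            ≈⟨ +-identityʳ _ ⟨
      ⟨ z , v zero ⟩ + 0#       ≈⟨ +-congˡ (trans (-‿cong (v⊥⇒u⊥ z ⊥v)) -0#≈0#) ⟨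
      ⟨ z , v zero ⟩ - ⟨ z , u ⟩ ≈⟨ homo-- (linearʳ z) (v zero) u ⟨
      ⟨ z , w ⟩                 ≈⟨ ⊥w ⟩
      0#                        ∎
    v⊥⇒⊥ : ∀ z → (∀ i → ⟨ z , v i ⟩ ≈ 0#) → ⟨ z , y +ᴹ t *ₗ w ⟩ ≈ 0#
    v⊥⇒⊥ z z⊥v = let L = linearʳ z in begin-equality
      ⟨ z , y +ᴹ t *ₗ w ⟩                           ≈⟨ trans (homo-+ L y _) (+-congˡ (homo-*ₗ L t w)) ⟩
      ⟨ z , y ⟩ + t * ⟨ z , w ⟩                     ≈⟨ +-cong (v⊥⇒y⊥ z (z⊥v ∘ suc)) (*-congˡ (homo-- L _ u)) ⟩
      0# + t * (⟨ z , v zero ⟩ - ⟨ z , u ⟩)         ≈⟨ +-identityˡ _ ⟩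
      t * (⟨ z , v zero ⟩ - ⟨ z , u ⟩)              ≈⟨ *-congˡ (+-cong (z⊥v zero) (-‿cong (v⊥⇒u⊥ z (z⊥v ∘ suc)))) ⟩
      t * (0# - 0#)                                 ≈⟨ *-congˡ (-‿inverseʳ 0#) ⟩
      t * 0#                                        ≈⟨ zeroʳ t ⟩
      0#                                            ∎

  -- Only the mass of the combination survives. Hence an average keeps every coordinate on which its
  -- members agree.
  Comb-constant : ∀ {p q} {P : Pred Carrier p} {S : Pred Carrierᴹ q} {f y} → Linear f →
                  (∀ {v} → v ∈ S → f v ≈ y) → ∀ {s x} → Comb P S s x → f x ≈ s * y
  Comb-constant L fS≈y (nil s≈0 x≈0) =
    trans (cong L x≈0) (trans (homo-0 L) (sym (trans (*-congʳ s≈0) (zeroˡ _))))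
  Comb-constant {f = f} {y} L fS≈y {s} {x} (cons {a} {v} {t} {z} _ v∈S d s≈ x≈) = begin-equality
    f x                  ≈⟨ trans (cong L x≈) (homo-+ L _ z) ⟩
    f (a *ₗ v) + f z     ≈⟨ +-cong (trans (homo-*ₗ L a v) (*-congˡ (fS≈y v∈S))) (Comb-constant L fS≈y d) ⟩
    a * y + t * y        ≈⟨ distribʳ y a t ⟨
    (a + t) * y          ≈⟨ *-congʳ s≈ ⟨
    s * y                ∎

  -- Bases with obtuse angles.

  LinearlyIndependent : ∀ {n} → (Fin n → Carrierᴹ) → Set _
  LinearlyIndependent v = ∀ a → combination a v ≈ᴹ 0ᴹ → ∀ i → a i ≈ 0#

  -- Subtracting the negative part x⁻ of x from x leaves the positive part, and an
  -- obtuse basis makes ⟨ x⁺ , x⁻ ⟩ ≤ 0; so ⟨ x , x⁻ ⟩ ≥ 0 forces x⁻ = 0.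
  obtuse-nonNeg : ∀ {n} (v : Fin n → Carrierᴹ) → LinearlyIndependent v →
    (∀ j k → j ≢ k → ⟨ v j , v k ⟩ ≤ 0#) →
    ∀ a → (∀ j → a j < 0# → 0# ≤ ⟨ combination a v , v j ⟩) → ∀ j → 0# ≤ a j
  obtuse-nonNeg {n} v independent obtuse a dominant j = 0≤aⱼ
    where
    negPart : ∀ x → Dec (x < 0#) → Carrier
    negPart x (yes _) = - x
    negPart x (no _)  = 0#
    b : Fin n → Carrier
    b j = negPart (a j) (a j <? 0#)
    x  = combination a v
    x⁻ = combination b v

    0≤b : ∀ j → 0# ≤ b j
    0≤b j with a j <? 0#
    ... | yes a<0 = inj₁ (x<0⇒0<-x a<0)
    ... | no  _   = ≤-refl
    0≤a+b : ∀ j → 0# ≤ a j + b j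
    0≤a+b j with a j <? 0#
    ... | yes _   = ≤-reflexive (sym (-‿inverseʳ (a j)))
    ... | no  a≮0 = ≤-trans (≮⇒≥ a≮0) (≤-reflexive (sym (+-identityʳ (a j))))
    disjoint : ∀ j → (a j + b j) * b j ≈ 0#
    disjoint j with a j <? 0#
    ... | yes _ = trans (*-congʳ (-‿inverseʳ (a j))) (zeroˡ _)
    ... | no  _ = zeroʳ _

    0≤⟨x,x⁻⟩ : 0# ≤ ⟨ x , x⁻ ⟩
    0≤⟨x,x⁻⟩ = ≤-trans (sum-nonNeg term) (≤-reflexive (sym (homo-combination (linearʳ x) b v)))
      where
      term : ∀ j → 0# ≤ b j * ⟨ x , v j ⟩
      term j with a j <? 0#
      -- Only indices with negative `a j` occur in `x⁻`, so `dominant` is available wherever it is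
      -- called for.
      ... | yes a<0 = *-nonNeg (inj₁ (x<0⇒0<-x a<0)) (dominant j a<0)
      ... | no  _   = ≤-reflexive (sym (zeroˡ _))

    ⟨x+x⁻,x⁻⟩≤0 : ⟨ x +ᴹ x⁻ , x⁻ ⟩ ≤ 0#
    ⟨x+x⁻,x⁻⟩≤0 = begin
      ⟨ x +ᴹ x⁻ , x⁻ ⟩
        ≈⟨ homo-+ (linearˡ x⁻) x x⁻ ⟩
      ⟨ x , x⁻ ⟩ + ⟨ x⁻ , x⁻ ⟩
        ≈⟨ +-cong (homo-combination (linearˡ x⁻) a v) (homo-combination (linearˡ x⁻) b v) ⟩
      sum (λ j → a j * ⟨ v j , x⁻ ⟩) + sum (λ j → b j * ⟨ v j , x⁻ ⟩)
        ≈⟨ ∑-distrib-+ (λ j → a j * ⟨ v j , x⁻ ⟩) (λ j → b j * ⟨ v j , x⁻ ⟩) ⟨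
      sum (λ j → a j * ⟨ v j , x⁻ ⟩ + b j * ⟨ v j , x⁻ ⟩)
        ≤⟨ sum-nonPos row ⟩
      0# ∎
      where
      entry : ∀ j k → (a j + b j) * (b k * ⟨ v j , v k ⟩) ≤ 0#
      entry j k with j Fin.≟ k
      -- Diagonal entries vanish because positive and negative parts have disjoint supports.
      ... | yes ≡.refl = ≤-reflexive (trans (sym (*-assoc _ _ _)) (trans (*-congʳ (disjoint j)) (zeroˡ _)))
      ... | no  j≢k    = *-nonNeg-nonPos (0≤a+b j) (*-nonNeg-nonPos (0≤b k) (obtuse j k j≢k))
      row : ∀ j → a j * ⟨ v j , x⁻ ⟩ + b j * ⟨ v j , x⁻ ⟩ ≤ 0#
      row j = begin
        a j * ⟨ v j , x⁻ ⟩ + b j * ⟨ v j , x⁻ ⟩             ≈⟨ distribʳ _ _ _ ⟨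
        (a j + b j) * ⟨ v j , x⁻ ⟩                          ≈⟨ *-congˡ (homo-combination (linearʳ (v j)) b v) ⟩
        (a j + b j) * sum (λ k → b k * ⟨ v j , v k ⟩)       ≈⟨ *-distribˡ-sum (a j + b j) (λ k → b k * ⟨ v j , v k ⟩) ⟩
        sum (λ k → (a j + b j) * (b k * ⟨ v j , v k ⟩))     ≤⟨ sum-nonPos (entry j) ⟩
        0#                                                  ∎

    ⟨x⁻,x⁻⟩≤0 : ⟨ x⁻ , x⁻ ⟩ ≤ 0#
    ⟨x⁻,x⁻⟩≤0 = begin
      ⟨ x⁻ , x⁻ ⟩                  ≈⟨ +-identityˡ _ ⟨
      0# + ⟨ x⁻ , x⁻ ⟩             ≤⟨ +-monoˡ-≤ _ 0≤⟨x,x⁻⟩ ⟩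
      ⟨ x , x⁻ ⟩ + ⟨ x⁻ , x⁻ ⟩     ≈⟨ homo-+ (linearˡ x⁻) x x⁻ ⟨
      ⟨ x +ᴹ x⁻ , x⁻ ⟩             ≤⟨ ⟨x+x⁻,x⁻⟩≤0 ⟩
      0#                           ∎

    b≈0 : b j ≈ 0#
    b≈0 = independent b (⟨,⟩-definite x⁻ (≤-antisym ⟨x⁻,x⁻⟩≤0 (⟨,⟩-nonneg x⁻))) j

    0≤aⱼ : 0# ≤ a j
    0≤aⱼ = begin
      0#         ≤⟨ 0≤a+b j ⟩
      a j + b j  ≈⟨ +-congˡ b≈0 ⟩
      a j + 0#   ≈⟨ +-identityʳ (a j) ⟩
      a j        ∎

  -- Pairings and reflections.

  pairing-linear : ∀ α → Linear (λ β → pairing β α)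
  pairing-linear α = record
    { cong    = λ x≈y → *-congʳ (*-congˡ (⟨,⟩-cong x≈y ≈ᴹ-refl))
    ; homo-+  = λ x y → trans (*-congʳ (trans (*-congˡ (⟨,⟩-additive x y α)) (distribˡ _ _ _))) (distribʳ _ _ _)
    ; homo-*ₗ = λ a x → trans (*-congʳ (trans (*-congˡ (⟨,⟩-scale a x α))
        (trans (sym (*-assoc _ _ _)) (trans (*-congʳ (*-comm _ _)) (*-assoc _ _ _))))) (*-assoc _ _ _)
    }

  pairing-norm : ∀ {α} → α ≉ᴹ 0ᴹ → ∀ β → pairing β α * ⟨ α , α ⟩ ≈ 2# * ⟨ β , α ⟩
  pairing-norm {α} α≉0 β = begin-equality
    2# * ⟨ β , α ⟩ * ⟨ α , α ⟩ ⁻¹ * ⟨ α , α ⟩     ≈⟨ *-assoc _ _ _ ⟩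
    2# * ⟨ β , α ⟩ * (⟨ α , α ⟩ ⁻¹ * ⟨ α , α ⟩)   ≈⟨ *-congˡ (trans (*-comm _ _) (⁻¹-inverseʳ-pos (⟨,⟩-pos α≉0))) ⟩
    2# * ⟨ β , α ⟩ * 1#                           ≈⟨ *-identityʳ _ ⟩
    2# * ⟨ β , α ⟩                                ∎

  pairing-self : ∀ {α} → α ≉ᴹ 0ᴹ → pairing α α ≈ 2#
  pairing-self α≉0 = trans (*-assoc _ _ _)
    (trans (*-congˡ (⁻¹-inverseʳ-pos (⟨,⟩-pos α≉0))) (*-identityʳ 2#))

  pairing-pos : ∀ {α β} → α ≉ᴹ 0ᴹ → 0# < ⟨ β , α ⟩ → 0# < pairing β α
  pairing-pos α≉0 0<βα = *-pos (*-pos 0<2 0<βα) (⁻¹-pos (⟨,⟩-pos α≉0))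

  homo-reflect : ∀ {f} → Linear f → ∀ α β → f (reflect α β) ≈ f β - pairing β α * f α
  homo-reflect L α β = trans (homo-- L β _) (+-congˡ (-‿cong (homo-*ₗ L _ α)))

  reflect-cong : ∀ α {β γ} → β ≈ᴹ γ → reflect α β ≈ᴹ reflect α γ
  reflect-cong α β≈γ = +ᴹ-cong β≈γ (-ᴹ‿cong (*ₗ-congʳ (cong (pairing-linear α) β≈γ)))

  x-2x≈-x : ∀ x → x - 2# * x ≈ - x
  x-2x≈-x x = begin-equality
    x - 2# * x       ≈⟨ +-congˡ (-‿cong (2x≈x+x x)) ⟩
    x - (x + x)      ≈⟨ +-congˡ (-‿+-comm x x) ⟨
    x + (- x - x)    ≈⟨ +-assoc x (- x) (- x) ⟨
    x - x - x        ≈⟨ +-congʳ (-‿inverseʳ x) ⟩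
    0# - x           ≈⟨ +-identityˡ (- x) ⟩
    - x              ∎

  reflect-self : ∀ {α} → α ≉ᴹ 0ᴹ → reflect α α ≈ᴹ -ᴹ α
  reflect-self {α} α≉0 = ⟨,⟩-extensional λ z → begin-equality
    ⟨ reflect α α , z ⟩                      ≈⟨ homo-reflect (linearˡ z) α α ⟩
    ⟨ α , z ⟩ - pairing α α * ⟨ α , z ⟩      ≈⟨ +-congˡ (-‿cong (*-congʳ (pairing-self α≉0))) ⟩
    ⟨ α , z ⟩ - 2# * ⟨ α , z ⟩               ≈⟨ x-2x≈-x _ ⟩
    - ⟨ α , z ⟩                              ≈⟨ homo-neg (linearˡ z) α ⟨
    ⟨ -ᴹ α , z ⟩                             ∎

  ⟨reflect,⟩ : ∀ {α} → α ≉ᴹ 0ᴹ → ∀ β → ⟨ reflect α β , α ⟩ ≈ - ⟨ β , α ⟩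
  ⟨reflect,⟩ {α} α≉0 β = trans (homo-reflect (linearˡ α) α β)
    (trans (+-congˡ (-‿cong (pairing-norm α≉0 β))) (x-2x≈-x _))

  reflect-involutive : ∀ {α} → α ≉ᴹ 0ᴹ → ∀ β → reflect α (reflect α β) ≈ᴹ β
  reflect-involutive {α} α≉0 β = ⟨,⟩-extensional λ z → let p = pairing β α; y = ⟨ α , z ⟩ in begin-equality
    ⟨ reflect α (reflect α β) , z ⟩
      ≈⟨ homo-reflect (linearˡ z) α _ ⟩
    ⟨ reflect α β , z ⟩ - pairing (reflect α β) α * y
      ≈⟨ +-cong (homo-reflect (linearˡ z) α β) (-‿cong (*-congʳ (trans (homo-reflect (pairing-linear α) α β)
           (+-congˡ (-‿cong (trans (*-congˡ (pairing-self α≉0)) (*-comm p 2#))))))) ⟩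
    ⟨ β , z ⟩ - p * y - (p - 2# * p) * y
      ≈⟨ +-congˡ (trans (-‿distribˡ-* _ y) (*-congʳ (trans (-‿cong (x-2x≈-x p)) (-‿involutive p)))) ⟩
    ⟨ β , z ⟩ - p * y + p * y
      ≈⟨ trans (+-assoc _ _ _) (trans (+-congˡ (-‿inverseˡ (p * y))) (+-identityʳ _)) ⟩
    ⟨ β , z ⟩ ∎

  -- Sums over lists closed under a reflection.

  lookup-injective : ∀ {xs} → Unique vectorSetoid xs → ∀ i j → lookup xs i ≈ᴹ lookup xs j → i ≡ j
  lookup-injective (_ ∷ _)     zero    zero    _  = ≡.refl
  lookup-injective u@(_ ∷ _)   zero    (suc j) eq = ⊥-elim (Unique[x∷xs]⇒x∉xs vectorSetoid u
    (∈-resp-≈ vectorSetoid (≈ᴹ-sym eq) (∈-lookup vectorSetoid _ j)))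
  lookup-injective u@(_ ∷ _)   (suc i) zero    eq = ⊥-elim (Unique[x∷xs]⇒x∉xs vectorSetoid u
    (∈-resp-≈ vectorSetoid eq (∈-lookup vectorSetoid _ i)))
  lookup-injective (_ ∷ u)     (suc i) (suc j) eq = ≡.cong suc (lookup-injective u i j eq)

  -- The reflection permutes the summands and negates their inner products with α.
  sum-orthogonal : ∀ {xs α} → Unique vectorSetoid xs → α ≉ᴹ 0ᴹ →
    (∀ {γ} → γ ∈ₗ xs → reflect α γ ∈ₗ xs) → ⟨ sumᴹ (lookup xs) , α ⟩ ≈ 0#
  sum-orthogonal {xs} {α} unique α≉0 closed = x≈-x⇒x≈0 (begin-equality
    ⟨ sumᴹ (lookup xs) , α ⟩                       ≈⟨ homo-sum (linearˡ α) (lookup xs) ⟩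
    sum (λ i → ⟨ lookup xs i , α ⟩)                ≈⟨ sum-permute (λ i → ⟨ lookup xs i , α ⟩) (permutation π π π-inv π-inv) ⟩
    sum (λ i → ⟨ lookup xs (π i) , α ⟩)            ≈⟨ sum-cong-≋ (λ i → trans (cong (linearˡ α) (lookup-π i)) (⟨reflect,⟩ α≉0 _)) ⟩
    sum (λ i → - ⟨ lookup xs i , α ⟩)              ≈⟨ sum-neg (λ i → ⟨ lookup xs i , α ⟩) ⟩
    - sum (λ i → ⟨ lookup xs i , α ⟩)              ≈⟨ -‿cong (homo-sum (linearˡ α) (lookup xs)) ⟨
    - ⟨ sumᴹ (lookup xs) , α ⟩                     ∎)
    where
    π : Fin (length xs) → Fin (length xs)
    π i = index (closed (∈-lookup vectorSetoid xs i))
    lookup-π : ∀ i → lookup xs (π i) ≈ᴹ reflect α (lookup xs i)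
    lookup-π i = ≈ᴹ-sym (lookup-index (closed (∈-lookup vectorSetoid xs i)))
    -- In a list without repetitions a vector determines its position, so the involution on vectors
    -- gives one on positions and `π` is its own inverse.
    π-inv : ∀ i → π (π i) ≡ i
    π-inv i = lookup-injective unique (π (π i)) i (≈ᴹ-trans (lookup-π (π i))
      (≈ᴹ-trans (reflect-cong α (lookup-π i)) (reflect-involutive α≉0 _)))

-- Coordinates and heights with respect to the simple roots.

module SimpleSystemProperties {c ℓ₁ ℓ₂ m ℓm} {K : OrderedField c ℓ₁ ℓ₂} {E : EuclideanSpace K m ℓm}
                              (R : RootSystem E) (Π : SimpleSystem R) where
  open OrderedField K hiding (zero)
  open OrderedFieldProperties K
  open EuclideanSpace E hiding (sum)
  open EuclideanProperties E
  open Linear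
  open RootSystem R
  open SimpleSystem Π
  open AbelianGroupProperties +ᴹ-abelianGroup
    using () renaming (⁻¹-involutive to -ᴹ-involutive; x∙y⁻¹≈ε⇒x≈y to x-y≈0⇒x≈y)
  open CMSum +ᴹ-commutativeMonoid using ()
    renaming (sum-cong-≋ to sumᴹ-cong; ∑-distrib-+ to sumᴹ-distrib-+)

  combination-+ : ∀ {n} (a b : Fin n → Carrier) v →
    combination (λ i → a i + b i) v ≈ᴹ combination a v +ᴹ combination b v
  combination-+ a b v = ≈ᴹ-trans (sumᴹ-cong λ i → *ₗ-distribʳ (v i) (a i) (b i))
    (sumᴹ-distrib-+ (λ i → a i *ₗ v i) (λ i → b i *ₗ v i))

  combination-* : ∀ {n} k (a : Fin n → Carrier) v →
    combination (λ i → k * a i) v ≈ᴹ k *ₗ combination a v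
  combination-* {ℕ.zero}  k a v = ≈ᴹ-sym (*ₗ-zeroʳ k)
  combination-* {ℕ.suc n} k a v = ≈ᴹ-trans
    (+ᴹ-cong (*ₗ-assoc k (a zero) (v zero)) (combination-* k (a ∘ suc) (v ∘ suc)))
    (≈ᴹ-sym (*ₗ-distribˡ k _ _))

  -- The Kronecker delta, by recursion on both indices so that sums and combinations unfold along
  -- with it.
  δ : ∀ {n} → Fin n → Fin n → Carrier
  δ zero    zero    = 1#
  δ zero    (suc k) = 0#
  δ (suc j) zero    = 0#
  δ (suc j) (suc k) = δ j k

  δ-refl : ∀ {n} (j : Fin n) → δ j j ≈ 1#
  δ-refl zero    = refl
  δ-refl (suc j) = δ-refl j

  δ-≢ : ∀ {n} {j k : Fin n} → j ≢ k → δ j k ≈ 0#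
  δ-≢ {j = zero}  {zero}  j≢k = ⊥-elim (j≢k ≡.refl)
  δ-≢ {j = zero}  {suc k} j≢k = refl
  δ-≢ {j = suc j} {zero}  j≢k = refl
  δ-≢ {j = suc j} {suc k} j≢k = δ-≢ (j≢k ∘ ≡.cong suc)

  sum-δ : ∀ {n} (j : Fin n) → sum (δ j) ≈ 1#
  sum-δ {ℕ.suc n} zero = trans (+-congˡ (sum-replicate-zero n)) (+-identityʳ 1#)
  sum-δ (suc j)        = trans (+-identityˡ _) (sum-δ j)

  combination-zero : ∀ {n} {a : Fin n → Carrier} v → (∀ i → a i ≈ 0#) → combination a v ≈ᴹ 0ᴹ
  combination-zero {ℕ.zero}  v a≈0 = ≈ᴹ-refl
  combination-zero {ℕ.suc n} v a≈0 = ≈ᴹ-trans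
    (+ᴹ-cong (≈ᴹ-trans (*ₗ-congʳ (a≈0 zero)) (*ₗ-zeroˡ _)) (combination-zero (v ∘ suc) (a≈0 ∘ suc)))
    (+ᴹ-identityˡ 0ᴹ)

  combination-δ : ∀ {n} (j : Fin n) v → combination (δ j) v ≈ᴹ v j
  combination-δ zero    v = ≈ᴹ-trans
    (+ᴹ-cong (*ₗ-identityˡ (v zero)) (combination-zero (v ∘ suc) λ _ → refl)) (+ᴹ-identityʳ _)
  combination-δ (suc j) v = ≈ᴹ-trans
    (+ᴹ-cong (*ₗ-zeroˡ (v zero)) (combination-δ j (v ∘ suc))) (+ᴹ-identityˡ _)

  ·ℕ≈·1*ₗ : ∀ n x → n ·ℕ x ≈ᴹ n ·1 *ₗ x
  ·ℕ≈·1*ₗ ℕ.zero    x = ≈ᴹ-sym (*ₗ-zeroˡ x)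
  ·ℕ≈·1*ₗ (ℕ.suc n) x = ≈ᴹ-trans (+ᴹ-cong (≈ᴹ-sym (*ₗ-identityˡ x)) (·ℕ≈·1*ₗ n x))
    (≈ᴹ-sym (*ₗ-distribʳ x 1# (n ·1)))

  root-expansion : ∀ {β} → β ∈ Φ → Σ[ k ∈ (Fin rank → ℕ) ]
    (β ≈ᴹ combination (λ j → k j ·1) simple ⊎ β ≈ᴹ combination (λ j → - 1# * k j ·1) simple)
  root-expansion β∈Φ with sameSign β∈Φ
  ... | k , inj₁ β≈ = k , inj₁ (≈ᴹ-trans β≈ (sumᴹ-cong λ j → ·ℕ≈·1*ₗ (k j) (simple j)))
  ... | k , inj₂ β≈ = k , inj₂ (≈ᴹ-trans β≈ (≈ᴹ-trans
    (-ᴹ‿cong (sumᴹ-cong λ j → ·ℕ≈·1*ₗ (k j) (simple j)))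
    (≈ᴹ-trans (≈ᴹ-sym (*ₗ-neg1 _)) (≈ᴹ-sym (combination-* (- 1#) (λ j → k j ·1) simple)))))

  coordinates : ∀ x → ∃[ a ] x ≈ᴹ combination a simple
  coordinates x = let n , v , b , v∈Φ , x≈ = spanning x
                      a , eq = span b v v∈Φ
                  in a , ≈ᴹ-trans x≈ eq
    where
    span : ∀ {n} (b : Fin n → Carrier) v → (∀ i → v i ∈ Φ) →
           ∃[ a ] combination b v ≈ᴹ combination a simple
    span {ℕ.zero}  b v v∈Φ = (λ _ → 0#) , ≈ᴹ-sym (combination-zero simple λ _ → refl)
    span {ℕ.suc n} b v v∈Φ with span (b ∘ suc) (v ∘ suc) (v∈Φ ∘ suc) | root-coordinates (v∈Φ zero)
      where
      root-coordinates : ∀ {β} → β ∈ Φ → ∃[ a ] β ≈ᴹ combination a simple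
      root-coordinates β∈Φ with root-expansion β∈Φ
      ... | _ , inj₁ β≈ = _ , β≈
      ... | _ , inj₂ β≈ = _ , β≈
    ... | a , tail≈ | d , v₀≈ = (λ j → b zero * d j + a j) ,
      ≈ᴹ-trans (+ᴹ-cong (≈ᴹ-trans (*ₗ-congˡ v₀≈) (≈ᴹ-sym (combination-* (b zero) d simple))) tail≈)
               (≈ᴹ-sym (combination-+ (λ j → b zero * d j) a simple))

  coord : Carrierᴹ → Fin rank → Carrier
  coord x = proj₁ (coordinates x)

  coord-expansion : ∀ x → x ≈ᴹ combination (coord x) simple
  coord-expansion x = proj₂ (coordinates x)

  -- Independence, applied to the difference of two expansions. `coord` reads off a chosen
  -- expansion, so its congruence and linearity have to be derived from this.
  coord-unique : ∀ {x a} → x ≈ᴹ combination a simple → ∀ j → coord x j ≈ a j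
  coord-unique {x} {a} x≈ j = begin-equality
    coord x j                ≈⟨ +-inverseˡ-unique _ _ (linearIndependence (λ j → coord x j + - 1# * a j) diff≈0 j) ⟩
    - (- 1# * a j)           ≈⟨ -‿cong (-1*x≈-x (a j)) ⟩
    - - a j                  ≈⟨ -‿involutive (a j) ⟩
    a j                      ∎
    where
    diff≈0 : combination (λ j → coord x j + - 1# * a j) simple ≈ᴹ 0ᴹ
    diff≈0 = ≈ᴹ-trans (combination-+ (coord x) (λ j → - 1# * a j) simple)
      (≈ᴹ-trans (+ᴹ-cong (≈ᴹ-sym (coord-expansion x))
        (≈ᴹ-trans (combination-* (- 1#) a simple) (≈ᴹ-trans (*ₗ-neg1 _) (-ᴹ‿cong (≈ᴹ-sym x≈)))))
        (-ᴹ‿inverseʳ x))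

  coord-linear : ∀ j → Linear (λ x → coord x j)
  coord-linear j = record
    { cong    = λ {x} {y} x≈y → coord-unique (≈ᴹ-trans x≈y (coord-expansion y)) j
    ; homo-+  = λ x y → coord-unique (≈ᴹ-trans (+ᴹ-cong (coord-expansion x) (coord-expansion y))
        (≈ᴹ-sym (combination-+ (coord x) (coord y) simple))) j
    ; homo-*ₗ = λ a x → coord-unique (≈ᴹ-trans (*ₗ-congˡ (coord-expansion x))
        (≈ᴹ-sym (combination-* a (coord x) simple))) j
    }

  coord-simple : ∀ j k → coord (simple j) k ≈ δ j k
  coord-simple j = coord-unique (≈ᴹ-sym (combination-δ j simple))

  coord-simple-refl : ∀ j → coord (simple j) j ≈ 1#
  coord-simple-refl j = trans (coord-simple j j) (δ-refl j)

  coord-simple-≢ : ∀ {j k} → j ≢ k → coord (simple j) k ≈ 0#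
  coord-simple-≢ j≢k = trans (coord-simple _ _) (δ-≢ j≢k)

  linear-expansion : ∀ {f} → Linear f → ∀ x → f x ≈ sum (λ j → coord x j * f (simple j))
  linear-expansion L x = trans (cong L (coord-expansion x)) (homo-combination L (coord x) simple)

  height : Carrierᴹ → Carrier
  height x = sum (coord x)

  height-linear : Linear height
  height-linear = record
    { cong    = λ x≈y → sum-cong-≋ λ j → cong (coord-linear j) x≈y
    ; homo-+  = λ x y → trans (sum-cong-≋ λ j → homo-+ (coord-linear j) x y) (∑-distrib-+ (coord x) (coord y))
    ; homo-*ₗ = λ a x → trans (sum-cong-≋ λ j → homo-*ₗ (coord-linear j) a x) (sym (*-distribˡ-sum a (coord x)))
    }

  height-simple : ∀ j → height (simple j) ≈ 1#
  height-simple j = trans (sum-cong-≋ (coord-simple j)) (sum-δ j)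

  -- Positive roots and integrality.

  Positive : Pred Carrierᴹ _
  Positive x = ∀ j → 0# ≤ coord x j

  Negative : Pred Carrierᴹ _
  Negative x = ∀ j → coord x j ≤ 0#

  positive-or-negative : ∀ {β} → β ∈ Φ → β ∈ Positive ⊎ β ∈ Negative
  positive-or-negative β∈Φ with root-expansion β∈Φ
  ... | k , inj₁ β≈ = inj₁ λ j → ≤-trans (·1-nonNeg (k j)) (≤-reflexive (sym (coord-unique β≈ j)))
  ... | k , inj₂ β≈ = inj₂ λ j → ≤-trans
    (≤-reflexive (trans (coord-unique β≈ j) (-1*x≈-x _))) (0≤x⇒-x≤0 (·1-nonNeg (k j)))

  height-bounded : ∀ {β} → β ∈ Φ → ∃[ N ] height β < N ·1
  height-bounded β∈Φ with root-expansion β∈Φ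
  ... | k , inj₁ β≈ = let N , Σk<N = sum-bounded k in
    N , <-respˡ-≈ (sum-cong-≋ λ j → sym (coord-unique β≈ j)) Σk<N
  -- A negative root has height at most zero, so one is a strict bound.
  ... | k , inj₂ β≈ = 1 , (begin-strict
    sum (coord _)   ≤⟨ sum-nonPos (λ j → ≤-trans (≤-reflexive (trans (coord-unique β≈ j) (-1*x≈-x _)))
                                                 (0≤x⇒-x≤0 (·1-nonNeg (k j)))) ⟩
    0#              <⟨ suc·1-pos 0 ⟩
    1 ·1            ∎)

  simple≉0 : ∀ j → simple j ≉ᴹ 0ᴹ
  simple≉0 j = nonzero (simple∈Φ j)

  Φ-resp : ∀ {β γ} → β ≈ᴹ γ → β ∈ Φ → γ ∈ Φ
  Φ-resp = ∈-resp-≈ vectorSetoid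

  Φ-neg : ∀ {β} → β ∈ Φ → -ᴹ β ∈ Φ
  Φ-neg β∈Φ = Φ-resp (reflect-self (nonzero β∈Φ)) (reflection-closed β∈Φ β∈Φ)

  1≤pairing : ∀ {α β} → α ∈ Φ → β ∈ Φ → 0# < ⟨ β , α ⟩ → 1# ≤ pairing β α
  1≤pairing α∈Φ β∈Φ 0<βα with crystallographic α∈Φ β∈Φ
  ... | k , p≈k = ≤-trans (fromℤ-pos⇒≥1 k (<-respʳ-≈ p≈k (pairing-pos (nonzero α∈Φ) 0<βα)))
                          (≤-reflexive (sym p≈k))

  -- A positive pairing is an integer, hence at least one; clear its denominator. Applied to the
  -- negative of an adjacent simple root, this bounds `weight`.
  norm≤2⟨,⟩ : ∀ {α β} → α ∈ Φ → β ∈ Φ → 0# < ⟨ β , α ⟩ → ⟨ α , α ⟩ ≤ 2# * ⟨ β , α ⟩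
  norm≤2⟨,⟩ {α} {β} α∈Φ β∈Φ 0<βα = begin
    ⟨ α , α ⟩                   ≈⟨ *-identityʳ _ ⟨
    ⟨ α , α ⟩ * 1#              ≤⟨ *-monoˡ-≤ (⟨,⟩-nonneg α) (1≤pairing α∈Φ β∈Φ 0<βα) ⟩
    ⟨ α , α ⟩ * pairing β α     ≈⟨ *-comm _ _ ⟩
    pairing β α * ⟨ α , α ⟩     ≈⟨ pairing-norm (nonzero α∈Φ) β ⟩
    2# * ⟨ β , α ⟩              ∎

  -- Were the inner product positive, reflecting `simple j` in `simple k` would give a root with
  -- coordinate `1#` at `j` and the negative coordinate `- p` at `k`, contrary to
  -- `positive-or-negative`.
  simple-obtuse : ∀ j k → j ≢ k → ⟨ simple j , simple k ⟩ ≤ 0#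
  simple-obtuse j k j≢k = ≮⇒≥ λ 0<jk →
    let p = pairing (simple j) (simple k)
        0<p = pairing-pos (simple≉0 k) 0<jk
        coordⱼ = begin-equality
          coord (reflect (simple k) (simple j)) j        ≈⟨ homo-reflect (coord-linear j) _ _ ⟩
          coord (simple j) j - p * coord (simple k) j    ≈⟨ +-cong (coord-simple-refl j) (-‿cong (trans
                                                              (*-congˡ (coord-simple-≢ (j≢k ∘ ≡.sym))) (zeroʳ p))) ⟩
          1# - 0#                                        ≈⟨ trans (+-congˡ -0#≈0#) (+-identityʳ 1#) ⟩
          1#                                             ∎
        coordₖ = begin-equality
          coord (reflect (simple k) (simple j)) k        ≈⟨ homo-reflect (coord-linear k) _ _ ⟩
          coord (simple j) k - p * coord (simple k) k    ≈⟨ +-cong (coord-simple-≢ j≢k) (-‿cong (trans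
                                                              (*-congˡ (coord-simple-refl k)) (*-identityʳ p))) ⟩
          0# - p                                         ≈⟨ +-identityˡ (- p) ⟩
          - p                                            ∎
    in [ (λ pos → <⇒≱ 0<p (≤-trans (≤-reflexive (sym (-‿involutive p)))
            (0≤x⇒-x≤0 (≤-trans (pos k) (≤-reflexive coordₖ)))))
       , (λ neg → <⇒≱ 0<1 (≤-trans (≤-reflexive (sym coordⱼ)) (neg j)))
       ]′ (positive-or-negative (reflection-closed (simple∈Φ k) (simple∈Φ j)))

  -- Roots in the span of the other simple roots.

  -- A positive root makes a positive inner product with some simple root, whose
  -- reflection lowers its height; it stays positive unless it was that simple root.
  positive∈Φ[] : ∀ i N {β} → β ∈ Φ → β ∈ Positive → coord β i ≈ 0# → height β < N ·1 → β ∈ Φ[ i ]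
  -- The bound is strict and positive roots have nonnegative height, so the measure never reaches
  -- zero.
  positive∈Φ[] i ℕ.zero    β∈Φ β≥0 βᵢ≈0 ht<0 = ⊥-elim (<⇒≱ ht<0 (sum-nonNeg β≥0))
  positive∈Φ[] i (ℕ.suc N) {β} β∈Φ β≥0 βᵢ≈0 ht<1+N
    -- Expanding `⟨ β , β ⟩` in the first slot gives a positive sum, so some term is positive.
    with sum-pos⇒∃pos (<-respʳ-≈ (linear-expansion (linearˡ β) β) (⟨,⟩-pos (nonzero β∈Φ)))
  ... | j , 0<βⱼ⟨j,β⟩ = by-sign (positive-or-negative sβ∈Φ)
    where
    α  = simple j
    sβ = reflect α β
    p  = pairing β α
    sβ∈Φ : sβ ∈ Φ
    sβ∈Φ = reflection-closed (simple∈Φ j) β∈Φ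
    -- The `i`-th term is zero, so the descent only reflects in the other simple roots.
    j≢i : j ≢ i
    j≢i ≡.refl = <-irrefl (sym (trans (*-congʳ βᵢ≈0) (zeroˡ _))) 0<βⱼ⟨j,β⟩
    1≤p : 1# ≤ p
    1≤p = 1≤pairing (simple∈Φ j) β∈Φ (<-respʳ-≈ (⟨,⟩-sym α β) (0<x*y⇒0<y (β≥0 j) 0<βⱼ⟨j,β⟩))
    coord-sβ : ∀ {k} → j ≢ k → coord sβ k ≈ coord β k
    coord-sβ {k} j≢k = begin-equality
      coord sβ k                   ≈⟨ homo-reflect (coord-linear k) α β ⟩
      coord β k - p * coord α k    ≈⟨ +-congˡ (-‿cong (trans (*-congˡ (coord-simple-≢ j≢k)) (zeroʳ p))) ⟩
      coord β k - 0#               ≈⟨ trans (+-congˡ -0#≈0#) (+-identityʳ _) ⟩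
      coord β k                    ∎
    ht-sβ<N : height sβ < N ·1
    ht-sβ<N = begin-strict
      height sβ                 ≈⟨ homo-reflect height-linear α β ⟩
      height β - p * height α   ≈⟨ +-congˡ (-‿cong (trans (*-congˡ (height-simple j)) (*-identityʳ p))) ⟩
      height β - p              ≤⟨ +-monoʳ-≤ (height β) (neg-mono-≤ 1≤p) ⟩
      height β - 1#             <⟨ +-monoˡ-< (- 1#) ht<1+N ⟩
      1# + N ·1 - 1#            ≈⟨ xyx⁻¹≈y 1# (N ·1) ⟩
      N ·1                      ∎
    α∈Φ[] : α ∈ Φ[ i ]
    α∈Φ[] = base (j , j≢i , ≈ᴹ-refl)
    by-sign : sβ ∈ Positive ⊎ sβ ∈ Negative → β ∈ Φ[ i ]
    by-sign (inj₁ sβ≥0) = resp (reflect-involutive (simple≉0 j) β)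
      (reflection α∈Φ[] (positive∈Φ[] i N sβ∈Φ sβ≥0 (trans (coord-sβ j≢i) βᵢ≈0) ht-sβ<N))
    -- Reflection changes only the `j`-th coordinate, so all others are both nonnegative and
    -- nonpositive. Thus `β` is a multiple of `α`; reducedness leaves the factors `1#` and `- 1#`,
    -- and positivity excludes the latter.
    by-sign (inj₂ sβ≤0) = resp (≈ᴹ-sym β≈α) α∈Φ[]
      where
      β≈βⱼα : β ≈ᴹ coord β j *ₗ α
      β≈βⱼα = ≈ᴹ-trans (coord-expansion β) (≈ᴹ-trans (sumᴹ-cong λ k → *ₗ-congʳ (coords k))
        (≈ᴹ-trans (combination-* (coord β j) (δ j) simple) (*ₗ-congˡ (combination-δ j simple))))
        where
        coords : ∀ k → coord β k ≈ coord β j * δ j k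
        coords k with j Fin.≟ k
        ... | yes ≡.refl = sym (trans (*-congˡ (δ-refl j)) (*-identityʳ _))
        ... | no  j≢k    = trans (≤-antisym (≤-trans (≤-reflexive (sym (coord-sβ j≢k))) (sβ≤0 k)) (β≥0 k))
                                 (sym (trans (*-congˡ (δ-≢ j≢k)) (zeroʳ _)))
      β≈α : β ≈ᴹ α
      β≈α with reduced (coord β j) (simple∈Φ j) (Φ-resp β≈βⱼα β∈Φ)
      ... | inj₁ βⱼ≈1  = ≈ᴹ-trans β≈βⱼα (≈ᴹ-trans (*ₗ-congʳ βⱼ≈1) (*ₗ-identityˡ α))
      ... | inj₂ βⱼ≈-1 = ⊥-elim (<⇒≱ 0<1 (≤-trans (≤-reflexive (sym (-‿involutive 1#)))
                                   (0≤x⇒-x≤0 (≤-trans (β≥0 j) (≤-reflexive βⱼ≈-1)))))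

  Φ[]⊆Φ : ∀ {i β} → β ∈ Φ[ i ] → β ∈ Φ
  Φ[]⊆Φ (base (j , _ , β≈))       = Φ-resp (≈ᴹ-sym β≈) (simple∈Φ j)
  Φ[]⊆Φ (reflection α∈Φ[] β∈Φ[])  = reflection-closed (Φ[]⊆Φ α∈Φ[]) (Φ[]⊆Φ β∈Φ[])
  Φ[]⊆Φ (resp α≈β α∈Φ[])          = Φ-resp α≈β (Φ[]⊆Φ α∈Φ[])

  Φ[]-neg : ∀ {i β} → β ∈ Φ[ i ] → -ᴹ β ∈ Φ[ i ]
  Φ[]-neg β∈Φ[] = resp (reflect-self (nonzero (Φ[]⊆Φ β∈Φ[]))) (reflection β∈Φ[] β∈Φ[])

  -- Only positive roots need the descent: a negative root is handled through its negative, `Φ[ i ]`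
  -- being symmetric.
  root∈Φ[] : ∀ {i β} → β ∈ Φ → coord β i ≈ 0# → β ∈ Φ[ i ]
  root∈Φ[] {i} {β} β∈Φ βᵢ≈0 with positive-or-negative β∈Φ
  ... | inj₁ β≥0 = let N , ht<N = height-bounded β∈Φ in positive∈Φ[] i N β∈Φ β≥0 βᵢ≈0 ht<N
  ... | inj₂ β≤0 = let N , ht<N = height-bounded (Φ-neg β∈Φ) in
    resp (-ᴹ-involutive β) (Φ[]-neg (positive∈Φ[] i N (Φ-neg β∈Φ)
      (λ j → ≤-trans (x≤0⇒0≤-x (β≤0 j)) (≤-reflexive (sym (homo-neg (coord-linear j) β))))
      (trans (homo-neg (coord-linear i) β) (trans (-‿cong βᵢ≈0) -0#≈0#)) ht<N))

  -- Averages over cosets of roots.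

  -- The translate of `β` by the span of the simple roots in `J`, put in coordinates to make
  -- membership decidable.
  coset : ∀ {q} → Pred (Fin rank) q → Carrierᴹ → Pred Carrierᴹ _
  coset J β γ = ∀ k → ¬ J k → coord γ k ≈ coord β k

  -- A reflection in a simple root of `J` alters only a coordinate in `J`, so it preserves the roots
  -- of the coset, and `sum-orthogonal` applies to their sum.
  coset-average : ∀ {q} {J : Pred (Fin rank) q} → Decidable J → ∀ {β} → β ∈ Φ →
    ∃[ x ] (Comb NonNeg (Φ ∩ coset J β) 1# x × (∀ k → J k → ⟨ x , simple k ⟩ ≈ 0#))
  coset-average {J = J} J? {β} β∈Φ = n⁻¹ *ₗ sumᴹ (lookup xs) , average , orthogonal
    where
    coset? : Decidable (coset J β)
    coset? γ = Fin.all? λ k → ¬? (J? k) →-dec (coord γ k ≟ coord β k)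
    coset-resp : ∀ {γ γ′} → γ ≈ᴹ γ′ → coset J β γ → coset J β γ′
    coset-resp γ≈γ′ γ∈ k k∉J = trans (cong (coord-linear k) (≈ᴹ-sym γ≈γ′)) (γ∈ k k∉J)
    vectorDecSetoid : DecSetoid m ℓm
    vectorDecSetoid = record { isDecEquivalence = record { isEquivalence = ≈ᴹ-isEquivalence ; _≟_ = _≟ᴹ_ } }
    -- `roots` may list a root repeatedly; each must occur once for reflections to permute
    -- positions.
    xs = filter coset? (deduplicate _≟ᴹ_ roots)
    n⁻¹ = length xs ·1 ⁻¹
    open SetoidMembership vectorSetoid using () renaming (_∈_ to _∈ₗ_)
    xs-unique : Unique vectorSetoid xs
    xs-unique = filter⁺ vectorSetoid coset? (deduplicate-! vectorDecSetoid roots)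
    ∈xs⁺ : ∀ {γ} → γ ∈ Φ ∩ coset J β → γ ∈ₗ xs
    ∈xs⁺ (γ∈Φ , γ∈) = ∈-filter⁺ vectorSetoid coset? coset-resp
      (∈-deduplicate⁺ vectorSetoid _≟ᴹ_ (λ z≈y x≈y → ≈ᴹ-trans x≈y (≈ᴹ-sym z≈y)) γ∈Φ) γ∈
    ∈xs⁻ : ∀ {γ} → γ ∈ₗ xs → γ ∈ Φ ∩ coset J β
    ∈xs⁻ γ∈xs with ∈-filter⁻ vectorSetoid coset? coset-resp γ∈xs
    ... | γ∈ , γ∈coset = ∈-deduplicate⁻ vectorSetoid _≟ᴹ_ roots γ∈ , γ∈coset
    0<n : 0# < length xs ·1
    -- `β` lies in its own coset, so the average is not over an empty list.
    0<n = inhabited⇒pos (index (∈xs⁺ (β∈Φ , λ _ _ → refl)))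
      where
      inhabited⇒pos : ∀ {n} → Fin n → 0# < n ·1
      inhabited⇒pos {ℕ.suc n} _ = suc·1-pos n
    average : Comb NonNeg (Φ ∩ coset J β) 1# (n⁻¹ *ₗ sumᴹ (lookup xs))
    average = Comb-resp
      (trans (*-congˡ (sum-replicate (length xs))) (trans (*-comm _ _) (⁻¹-inverseʳ-pos 0<n)))
      (*ₗ-congˡ (sumᴹ-cong λ i → *ₗ-identityˡ (lookup xs i)))
      (Comb-scale (*-nonNeg (inj₁ (⁻¹-pos 0<n))) (Comb-sum (λ _ → 1#) (λ i → 1# *ₗ lookup xs i)
        λ i → Comb-single (inj₁ 0<1) (∈xs⁻ (∈-lookup vectorSetoid xs i))))
    orthogonal : ∀ k → J k → ⟨ n⁻¹ *ₗ sumᴹ (lookup xs) , simple k ⟩ ≈ 0#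
    orthogonal k k∈J = trans (⟨,⟩-scale n⁻¹ _ _) (trans (*-congˡ (sum-orthogonal xs-unique (simple≉0 k) closed)) (zeroʳ _))
      where
      closed : ∀ {γ} → γ ∈ₗ xs → reflect (simple k) γ ∈ₗ xs
      closed {γ} γ∈xs with ∈xs⁻ γ∈xs
      ... | γ∈Φ , γ∈ = ∈xs⁺ (reflection-closed (simple∈Φ k) γ∈Φ , λ l l∉J → begin-equality
        coord (reflect (simple k) γ) l          ≈⟨ homo-reflect (coord-linear l) _ γ ⟩
        coord γ l - pairing γ (simple k) * coord (simple k) l
          ≈⟨ +-cong (γ∈ l l∉J) (-‿cong (trans (*-congˡ (coord-simple-≢ λ { ≡.refl → l∉J k∈J })) (zeroʳ _))) ⟩
        coord β l - 0#                          ≈⟨ trans (+-congˡ -0#≈0#) (+-identityʳ _) ⟩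
        coord β l                               ∎)

  -- From combinations to the root polytope.

  Generated-nonempty : ∀ {p} {S : Pred Carrierᴹ p} {γ} → γ ∈ Generated S → ∃[ β ] β ∈ S
  Generated-nonempty (base β∈S)        = _ , β∈S
  Generated-nonempty (reflection α∈ _) = Generated-nonempty α∈
  Generated-nonempty (resp _ α∈)       = Generated-nonempty α∈

  -- Mass r - s is added without moving x, by splitting it equally over γ and - γ.
  Comb-fill : ∀ {i s r x γ} → γ ∈ Φ[ i ] → s ≤ r → Comb NonNeg Φ[ i ] s x → Comb NonNeg Φ[ i ] r x
  Comb-fill {i} {s} {r} {x} {γ} γ∈ s≤r d = Comb-resp mass vector
    (Comb-+ d (Comb-+ (Comb-single 0≤h γ∈) (Comb-single 0≤h (Φ[]-neg γ∈))))
    where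
    h = (r - s) * 2# ⁻¹
    0≤h : 0# ≤ h
    0≤h = *-nonNeg (x≤y⇒0≤y-x s≤r) (inj₁ (⁻¹-pos 0<2))
    mass : s + (h + h) ≈ r
    mass = begin-equality
      s + (h + h)                ≈⟨ +-congˡ (2x≈x+x h) ⟨
      s + 2# * h                 ≈⟨ +-congˡ (trans (*-comm 2# h) (*-assoc _ _ _)) ⟩
      s + (r - s) * (2# ⁻¹ * 2#) ≈⟨ +-congˡ (*-congˡ (trans (*-comm _ _) (⁻¹-inverseʳ-pos 0<2))) ⟩
      s + (r - s) * 1#           ≈⟨ +-congˡ (*-identityʳ _) ⟩
      s + (r - s)                ≈⟨ +-assoc s r (- s) ⟨
      s + r - s                  ≈⟨ xyx⁻¹≈y s r ⟩
      r                          ∎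
    vector : x +ᴹ (h *ₗ γ +ᴹ h *ₗ (-ᴹ γ)) ≈ᴹ x
    vector = ≈ᴹ-trans (+ᴹ-congˡ (≈ᴹ-trans (≈ᴹ-sym (*ₗ-distribˡ h γ (-ᴹ γ)))
      (≈ᴹ-trans (*ₗ-congˡ (-ᴹ‿inverseʳ γ)) (*ₗ-zeroʳ h)))) (+ᴹ-identityʳ x)

  -- With another simple root at hand, fill the mass up to `r` and divide by `r`. In rank one
  -- `Φ[ i ]` is empty, so the combination is zero and the convention for the polytope applies.
  Comb⇒∙RootPolytope : ∀ {i s r x} → 0# < r → s ≤ r → Comb NonNeg Φ[ i ] s x →
                       x ∈ r ∙ RootPolytope Φ[ i ]
  Comb⇒∙RootPolytope {i} {s} {r} {x} 0<r s≤r d with Fin.any? (λ j → ¬? (j Fin.≟ i))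
  ... | yes (j , j≢i) = r ⁻¹ *ₗ x ,
    inj₁ (Comb⇒ConvexHull (Comb-resp r⁻¹r≈1 ≈ᴹ-refl
      (Comb-scale (*-nonNeg (inj₁ (⁻¹-pos 0<r))) (Comb-fill (base (j , j≢i , ≈ᴹ-refl)) s≤r d)))) ,
    ≈ᴹ-sym (≈ᴹ-trans (≈ᴹ-sym (*ₗ-assoc r (r ⁻¹) x))
      (≈ᴹ-trans (*ₗ-congʳ (⁻¹-inverseʳ-pos 0<r)) (*ₗ-identityˡ x)))
    where
    r⁻¹r≈1 : r ⁻¹ * r ≈ 1#
    r⁻¹r≈1 = trans (*-comm _ _) (⁻¹-inverseʳ-pos 0<r)
  ... | no none = 0ᴹ , inj₂ (empty , ≈ᴹ-refl) , ≈ᴹ-trans (x≈0 d) (≈ᴹ-sym (*ₗ-zeroʳ r))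
    where
    empty : ∀ γ → ¬ (γ ∈ Φ[ i ])
    empty γ γ∈ = let _ , j , j≢i , _ = Generated-nonempty γ∈ in none (j , j≢i)
    x≈0 : Comb NonNeg Φ[ i ] s x → x ≈ᴹ 0ᴹ
    x≈0 (nil _ x≈)          = x≈
    x≈0 (cons _ v∈ _ _ _)   = ⊥-elim (empty _ v∈)

  -- The projection of a simple root and its coordinates.

  module Projection (i : Fin rank) where

    α : Carrierᴹ
    α = simple i

    -- Putting the zero vector in place of `α` keeps the index set `Fin rank`; `project` tolerates
    -- zero vectors.
    other : ∀ j → Dec (j ≡ i) → Carrierᴹ
    other j (yes _) = 0ᴹ
    other j (no  _) = simple j

    other-InSpan : ∀ j d → InSpan (others i) (other j d)
    other-InSpan j (yes _)   = 0# , nil refl ≈ᴹ-refl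
    other-InSpan j (no  j≢i) = 1# ,
      Comb-resp refl (*ₗ-identityˡ _) (Comb-single {a = 1#} _ (j , j≢i , ≈ᴹ-refl))

    projection : ∃[ y ] (InSpan (others i) y × (∀ j → j ≢ i → ⟨ α -ᴹ y , simple j ⟩ ≈ 0#) ×
                         ⟨ α -ᴹ y , y ⟩ ≈ 0#)
    projection with project (λ j → other j (j Fin.≟ i)) (λ j → other-InSpan j (j Fin.≟ i)) α
    ... | y , y∈S , ⊥v , v⊥⇒⊥ = y , y∈S , ⊥simple , v⊥⇒⊥ (α -ᴹ y) ⊥v
      where
      ⊥simple : ∀ j → j ≢ i → ⟨ α -ᴹ y , simple j ⟩ ≈ 0#
      ⊥simple j j≢i with j Fin.≟ i | ⊥v j
      ... | yes j≡i | _  = ⊥-elim (j≢i j≡i)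
      ... | no  _   | ⊥j = ⊥j

    ᾱ : Carrierᴹ
    ᾱ = proj₁ projection

    ᾱ-InSpan : InSpan (others i) ᾱ
    ᾱ-InSpan = proj₁ (proj₂ projection)

    α-ᾱ⊥simple : ∀ j → j ≢ i → ⟨ α -ᴹ ᾱ , simple j ⟩ ≈ 0#
    α-ᾱ⊥simple = proj₁ (proj₂ (proj₂ projection))

    α-ᾱ⊥ᾱ : ⟨ α -ᴹ ᾱ , ᾱ ⟩ ≈ 0#
    α-ᾱ⊥ᾱ = proj₂ (proj₂ (proj₂ projection))

    ᾱ-isOrthogonalProjection : IsOrthogonalProjection (others i) α ᾱ
    ᾱ-isOrthogonalProjection = InSpan⇒Span ᾱ-InSpan , λ z →
      vanishes-on-Span (linearʳ (α -ᴹ ᾱ)) {S = others i} λ { (j , j≢i , x≈) →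
        trans (cong (linearʳ (α -ᴹ ᾱ)) x≈) (α-ᾱ⊥simple j j≢i) }

    ⟨ᾱ,simple⟩ : ∀ j → j ≢ i → ⟨ ᾱ , simple j ⟩ ≈ ⟨ α , simple j ⟩
    ⟨ᾱ,simple⟩ j j≢i = sym (x∙y⁻¹≈ε⇒x≈y _ _
      (trans (sym (homo-- (linearˡ (simple j)) α ᾱ)) (α-ᾱ⊥simple j j≢i)))

    coord-ᾱ : coord ᾱ i ≈ 0#
    coord-ᾱ = vanishes-on-Span (coord-linear i) {S = others i} (λ { (j , j≢i , x≈) →
      trans (cong (coord-linear i) x≈) (coord-simple-≢ j≢i) }) (InSpan⇒Span ᾱ-InSpan)

    -- The gap is the squared norm of `α -ᴹ ᾱ`, which is nonzero because its `i`-th coordinate is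
    -- `1#`.
    ⟨ᾱ,α⟩<⟨α,α⟩ : ⟨ ᾱ , α ⟩ < ⟨ α , α ⟩
    ⟨ᾱ,α⟩<⟨α,α⟩ = begin-strict
      ⟨ ᾱ , α ⟩                               ≈⟨ +-identityˡ _ ⟨
      0# + ⟨ ᾱ , α ⟩                          <⟨ +-monoˡ-< _ (⟨,⟩-pos α-ᾱ≉0) ⟩
      ⟨ α -ᴹ ᾱ , α -ᴹ ᾱ ⟩ + ⟨ ᾱ , α ⟩         ≈⟨ +-congʳ (homo-- (linearʳ (α -ᴹ ᾱ)) α ᾱ) ⟩
      ⟨ α -ᴹ ᾱ , α ⟩ - ⟨ α -ᴹ ᾱ , ᾱ ⟩ + ⟨ ᾱ , α ⟩
        ≈⟨ +-congʳ (trans (+-congˡ (trans (-‿cong α-ᾱ⊥ᾱ) -0#≈0#)) (+-identityʳ _)) ⟩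
      ⟨ α -ᴹ ᾱ , α ⟩ + ⟨ ᾱ , α ⟩              ≈⟨ +-congʳ (homo-- (linearˡ α) α ᾱ) ⟩
      ⟨ α , α ⟩ - ⟨ ᾱ , α ⟩ + ⟨ ᾱ , α ⟩       ≈⟨ +-assoc _ _ _ ⟩
      ⟨ α , α ⟩ + (- ⟨ ᾱ , α ⟩ + ⟨ ᾱ , α ⟩)   ≈⟨ trans (+-congˡ (-‿inverseˡ _)) (+-identityʳ _) ⟩
      ⟨ α , α ⟩                               ∎
      where
      α-ᾱ≉0 : α -ᴹ ᾱ ≉ᴹ 0ᴹ
      α-ᾱ≉0 eq = 0≉1 (begin-equality
        0#                      ≈⟨ homo-0 (coord-linear i) ⟨
        coord 0ᴹ i              ≈⟨ cong (coord-linear i) eq ⟨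
        coord (α -ᴹ ᾱ) i        ≈⟨ homo-- (coord-linear i) α ᾱ ⟩
        coord α i - coord ᾱ i   ≈⟨ +-cong (coord-simple-refl i) (trans (-‿cong coord-ᾱ) -0#≈0#) ⟩
        1# + 0#                 ≈⟨ +-identityʳ 1# ⟩
        1#                      ∎)

    b : Fin rank → Carrier
    b = coord (-ᴹ ᾱ)

    bᵢ≈0 : b i ≈ 0#
    bᵢ≈0 = trans (homo-neg (coord-linear i) ᾱ) (trans (-‿cong coord-ᾱ) -0#≈0#)

    ⟨-ᾱ,simple⟩ : ∀ j → j ≢ i → ⟨ -ᴹ ᾱ , simple j ⟩ ≈ - ⟨ α , simple j ⟩
    ⟨-ᾱ,simple⟩ j j≢i = trans (homo-neg (linearˡ (simple j)) ᾱ) (-‿cong (⟨ᾱ,simple⟩ j j≢i))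

    -- `obtuse-nonNeg` is applied to the full basis. Its condition at `i` is vacuous since `b i` is
    -- zero, and at the other indices it is the obtuseness of `α` with `simple j`.
    0≤b : ∀ j → 0# ≤ b j
    0≤b = obtuse-nonNeg simple linearIndependence simple-obtuse b λ j bⱼ<0 →
      let j≢i = λ { ≡.refl → <-irrefl bᵢ≈0 bⱼ<0 } in begin
      0#                                   ≤⟨ x≤0⇒0≤-x (simple-obtuse i j (j≢i ∘ ≡.sym)) ⟩
      - ⟨ α , simple j ⟩                   ≈⟨ ⟨-ᾱ,simple⟩ j j≢i ⟨
      ⟨ -ᴹ ᾱ , simple j ⟩                  ≈⟨ cong (linearˡ (simple j)) (coord-expansion (-ᴹ ᾱ)) ⟩
      ⟨ combination b simple , simple j ⟩  ∎

    -- Averaging the contributions of the adjacent simple roots.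

    -- The set `J` of the averaging. By `simple-obtuse`, not being negative here means being zero.
    Perpendicular : Pred (Fin rank) _
    Perpendicular k = k ≢ i × ¬ (⟨ α , simple k ⟩ < 0#)

    perpendicular? : Decidable Perpendicular
    perpendicular? k = ¬? (k Fin.≟ i) ×-dec ¬? (⟨ α , simple k ⟩ <? 0#)

    data Position (j : Fin rank) : Set (ℓ₁ ⊔ ℓ₂) where
      self          : j ≡ i → Position j
      perpendicular : j ≢ i → ⟨ α , simple j ⟩ ≈ 0# → Position j
      adjacent      : j ≢ i → ⟨ α , simple j ⟩ < 0# → Position j

    position : ∀ j → Position j
    position j with j Fin.≟ i | ⟨ α , simple j ⟩ <? 0#
    ... | yes j≡i | _           = self j≡i
    ... | no  j≢i | yes ⟨α,j⟩<0 = adjacent j≢i ⟨α,j⟩<0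
    ... | no  j≢i | no  ⟨α,j⟩≮0 = perpendicular j≢i
      (≤-antisym (simple-obtuse i j (j≢i ∘ ≡.sym)) (≮⇒≥ ⟨α,j⟩≮0))

    -- Replacing each adjacent simple root in - ᾱ = Σ b j *ₗ simple j by the average of
    -- its coset absorbs the summands with simple j perpendicular to α.
    record Piece (j : Fin rank) : Set (c ⊔ ℓ₁ ⊔ ℓ₂ ⊔ m ⊔ ℓm) where
      field
        weight      : Carrier
        vector      : Carrierᴹ
        comb        : Comb NonNeg Φ[ i ] weight vector
        coord≈      : ∀ k → ¬ Perpendicular k → coord vector k ≈ b j * coord (simple j) k
        orthogonal  : ∀ k → Perpendicular k → ⟨ vector , simple k ⟩ ≈ 0#
        -- Summed over `j`, the right-hand sides give `2# * ⟨ ᾱ , α ⟩`.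
        weight≤     : weight * ⟨ α , α ⟩ ≤ b j * (2# * ⟨ -ᴹ simple j , α ⟩)

    piece : ∀ j → Position j → Piece j
    piece j (self ≡.refl) = record
      { weight     = 0#
      ; vector     = 0ᴹ
      ; comb       = nil refl ≈ᴹ-refl
      ; coord≈     = λ k _ → trans (homo-0 (coord-linear k)) (sym (trans (*-congʳ bᵢ≈0) (zeroˡ _)))
      ; orthogonal = λ k _ → homo-0 (linearˡ (simple k))
      ; weight≤    = ≤-reflexive (trans (zeroˡ _) (sym (trans (*-congʳ bᵢ≈0) (zeroˡ _))))
      }
    piece j (perpendicular j≢i ⟨α,j⟩≈0) = record
      { weight     = 0#
      ; vector     = 0ᴹ
      ; comb       = nil refl ≈ᴹ-refl
      -- Dropping this summand costs nothing: its only nonzero coordinate is at `j`, which is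
      -- perpendicular and so not compared.
      ; coord≈     = λ k k∉ → trans (homo-0 (coord-linear k)) (sym (trans
          (*-congˡ (coord-simple-≢ λ { ≡.refl → k∉ (j≢i , <-irrefl ⟨α,j⟩≈0) })) (zeroʳ _)))
      ; orthogonal = λ k _ → homo-0 (linearˡ (simple k))
      ; weight≤    = ≤-reflexive (trans (zeroˡ _) (sym (trans (*-congˡ (trans (*-congˡ ⟨-j,α⟩≈0) (zeroʳ 2#))) (zeroʳ _))))
      }
      where
      ⟨-j,α⟩≈0 : ⟨ -ᴹ simple j , α ⟩ ≈ 0#
      ⟨-j,α⟩≈0 = trans (homo-neg (linearˡ α) (simple j))
        (trans (-‿cong (trans (⟨,⟩-sym _ _) ⟨α,j⟩≈0)) -0#≈0#)
    piece j (adjacent j≢i ⟨α,j⟩<0) = let x , average , x⊥ = coset-average perpendicular? (simple∈Φ j) in record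
      { weight     = b j
      ; vector     = b j *ₗ x
      ; comb       = Comb-resp (*-identityʳ (b j)) ≈ᴹ-refl (Comb-scale (*-nonNeg (0≤b j))
          -- The index `i` is not in `J`, so roots of the coset share the zero `i`-th coordinate of
          -- `simple j`, and `root∈Φ[]` applies.
          (Comb-map (λ { (γ∈Φ , γ∈) → root∈Φ[] γ∈Φ (trans (γ∈ i λ i∈ → proj₁ i∈ ≡.refl) (coord-simple-≢ j≢i)) }) average))
      ; coord≈     = λ k k∉ → trans (homo-*ₗ (coord-linear k) (b j) x) (*-congˡ
          (trans (Comb-constant (coord-linear k) (λ γ∈ → proj₂ γ∈ k k∉) average) (*-identityˡ _)))
      ; orthogonal = λ k k∈ → trans (⟨,⟩-scale (b j) x (simple k)) (trans (*-congˡ (x⊥ k k∈)) (zeroʳ _))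
      ; weight≤    = *-monoˡ-≤ (0≤b j) (norm≤2⟨,⟩ (simple∈Φ i) (Φ-neg (simple∈Φ j)) 0<⟨-j,α⟩)
      }
      where
      0<⟨-j,α⟩ : 0# < ⟨ -ᴹ simple j , α ⟩
      0<⟨-j,α⟩ = <-respʳ-≈ (trans (-‿cong (⟨,⟩-sym _ _)) (sym (homo-neg (linearˡ α) (simple j)))) (x<0⇒0<-x ⟨α,j⟩<0)

    pieces : ∀ j → Piece j
    pieces j = piece j (position j)
    module Pieces j = Piece (pieces j)
    open Pieces

    -- The resulting combination and its mass.

    mass : Carrier
    mass = sum weight

    -- In the expansion of `⟨ e , e ⟩` over the simple roots each term has a zero factor: the inner
    -- product at perpendicular indices, the coordinate at all others.
    -ᾱ≈Σvector : -ᴹ ᾱ ≈ᴹ sumᴹ vector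
    -ᾱ≈Σvector = x-y≈0⇒x≈y _ _ (⟨,⟩-definite e
      (trans (linear-expansion (linearˡ e) e) (sum-zero λ k → trans (*-congˡ (⟨,⟩-sym _ _)) (term k (perpendicular? k)))))
      where
      e = -ᴹ ᾱ -ᴹ sumᴹ vector
      term : ∀ k → Dec (Perpendicular k) → coord e k * ⟨ e , simple k ⟩ ≈ 0#
      term k (yes k∈@(k≢i , ⟨α,k⟩≮0)) = trans (*-congˡ (begin-equality
        ⟨ e , simple k ⟩
          ≈⟨ homo-- (linearˡ (simple k)) _ _ ⟩
        ⟨ -ᴹ ᾱ , simple k ⟩ - ⟨ sumᴹ vector , simple k ⟩
          ≈⟨ +-cong (⟨-ᾱ,simple⟩ k k≢i) (-‿cong (trans (homo-sum (linearˡ (simple k)) vector)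
               (sum-zero λ j → orthogonal j k k∈))) ⟩
        - ⟨ α , simple k ⟩ - 0#
          ≈⟨ +-congʳ (-‿cong (≤-antisym (simple-obtuse i k (k≢i ∘ ≡.sym)) (≮⇒≥ ⟨α,k⟩≮0))) ⟩
        - 0# - 0#
          ≈⟨ trans (-‿+-comm 0# 0#) (trans (-‿cong (+-identityˡ 0#)) -0#≈0#) ⟩
        0# ∎)) (zeroʳ _)
      term k (no k∉) = trans (*-congʳ (begin-equality
        coord e k
          ≈⟨ homo-- (coord-linear k) _ _ ⟩
        b k - coord (sumᴹ vector) k
          ≈⟨ +-cong (linear-expansion (coord-linear k) (-ᴹ ᾱ))
               (-‿cong (trans (homo-sum (coord-linear k) vector) (sum-cong-≋ λ j → coord≈ j k k∉))) ⟩
        sum (λ j → b j * coord (simple j) k) - sum (λ j → b j * coord (simple j) k)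
          ≈⟨ -‿inverseʳ _ ⟩
        0# ∎)) (zeroˡ _)

    -- The `b j` are the coordinates of `-ᴹ ᾱ`, so the two signs cancel when `weight≤` is summed.
    -- Strictness comes from `⟨ᾱ,α⟩<⟨α,α⟩`.
    mass<2 : mass < 2#
    mass<2 = *-cancelʳ-< (⟨,⟩-nonneg α) (begin-strict
      mass * ⟨ α , α ⟩
        ≈⟨ *-distribʳ-sum ⟨ α , α ⟩ weight ⟩
      sum (λ j → weight j * ⟨ α , α ⟩)
        ≤⟨ sum-mono-≤ weight≤ ⟩
      sum (λ j → b j * (2# * ⟨ -ᴹ simple j , α ⟩))
        ≈⟨ sum-cong-≋ (λ j → trans (sym (*-assoc _ _ _)) (trans (*-congʳ (*-comm _ _)) (trans (*-assoc _ _ _)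
             (*-congˡ (trans (*-congˡ (homo-neg (linearˡ α) (simple j))) (sym (-‿distribʳ-* _ _))))))) ⟩
      sum (λ j → 2# * - (b j * ⟨ simple j , α ⟩))
        ≈⟨ *-distribˡ-sum 2# (λ j → - (b j * ⟨ simple j , α ⟩)) ⟨
      2# * sum (λ j → - (b j * ⟨ simple j , α ⟩))
        ≈⟨ *-congˡ (trans (sum-neg (λ j → b j * ⟨ simple j , α ⟩)) (-‿cong (sym (linear-expansion (linearˡ α) (-ᴹ ᾱ))))) ⟩
      2# * - ⟨ -ᴹ ᾱ , α ⟩
        ≈⟨ *-congˡ (trans (-‿cong (homo-neg (linearˡ α) ᾱ)) (-‿involutive _)) ⟩
      2# * ⟨ ᾱ , α ⟩
        ≈⟨ 2x≈x+x _ ⟩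
      ⟨ ᾱ , α ⟩ + ⟨ ᾱ , α ⟩
        <⟨ +-mono-< ⟨ᾱ,α⟩<⟨α,α⟩ ⟨ᾱ,α⟩<⟨α,α⟩ ⟩
      ⟨ α , α ⟩ + ⟨ α , α ⟩
        ≈⟨ 2x≈x+x _ ⟨
      2# * ⟨ α , α ⟩ ∎)

    ᾱ-Comb : Comb NonNeg Φ[ i ] mass ᾱ
    ᾱ-Comb = Comb-resp refl (-ᴹ-involutive ᾱ) (Comb-neg Φ[]-neg
      (Comb-resp refl (≈ᴹ-sym -ᾱ≈Σvector) (Comb-sum weight vector comb)))

-- One dilation factor for all simple roots.

lemma7p2 : ∀ {c ℓ₁ ℓ₂ m ℓm} (ℝ : OrderedField c ℓ₁ ℓ₂) → DedekindComplete ℝ →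
  (E : EuclideanSpace ℝ m ℓm) (R : RootSystem E) → Irreducible R →
  (Π : SimpleSystem R) →
  let open OrderedField ℝ
      open EuclideanSpace E
      open SimpleSystem Π
  in ∃[ r ] (0# < r × r < 2# ×
       (∀ i → ∃[ ᾱ ] (IsOrthogonalProjection (others i) (simple i) ᾱ ×
                      ᾱ ∈ r ∙ RootPolytope Φ[ i ])))
lemma7p2 ℝ _ E R _ Π =
  -- Starting the maximum at `1#` keeps `r` positive even when every mass is zero, as in rank one.
  let r , 1≤r , r<2 , mass≤r = upperBound 1<2 mass mass<2
      0<r = [ <-trans 0<1 , (λ 1≈r → <-respʳ-≈ 1≈r 0<1) ]′ 1≤r
  in r , 0<r , r<2 , λ i →
    ᾱ i , ᾱ-isOrthogonalProjection i , Comb⇒∙RootPolytope 0<r (mass≤r i) (ᾱ-Comb i)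
  where
  open OrderedFieldProperties ℝ
  open SimpleSystemProperties R Π
  open Projection
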